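{- Let $G=(V,E)$ be a graph. For each edge subset $B\subseteq E$ such that the spanning subgraph $(V,B)$ is bipartite, fix a bipartition $V=Y_B\cup Z_B$ of $(V,B)$, let $(V_1,E_1),\dots,(V_k,E_k)$ be the components of $(V,B)$ with nonempty edge sets, let $l$ be the number of components of $(V,B)$ that are isomorphic to $K_1$ (isolated vertices), and put $$h(B)=x^{l}\prod_{i=1}^{k}(-1)^{|E_i|}\left[(-1)^{|Y_B\cap V_i|}x^{|Z_B\cap V_i|}+(-1)^{|Z_B\cap V_i|}x^{|Y_B\cap V_i|}\right].$$ Then $$D(G,x)=\sum_{\substack{B\subseteq E\\ (V,B)\text{ is bipartite}}}h(B).$$
   Context: All graphs are finite, simple and undirected. For a graph $G=(V,E)$, the closed neighborhood $N_G[v]$ of a vertex $v$ is the set consisting of $v$ and all its neighbors, and $N_G[W]=\bigcup_{v\in W}N_G[v]$ for $W\subseteq V$. A set $W\subseteq V$ is dominating in $G$ if $N_G[W]=V$. The domination polynomial is $D(G,x)=\sum_{k=0}^{|V|}d_k(G)x^k$, where $d_k(G)$ is the number of dominating sets of $G$ of cardinality $k$. A graph with vertex set $V$ is bipartite with bipartition $V=Y\cup Z$ if $Y,Z$ are disjoint (possibly empty) and every edge has one end vertex in $Y$ and the other in $Z$. Empty products are equal to $1$. (The quantities $k$, $l$, $V_i$, $E_i$ depend on $B$.) -}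

module Defs where

open import Algebra.Bundles using (RawSemiring)
import Algebra.Definitions.RawSemiring as RawSemiringDefinitions
import Data.Bool.Properties as Bool
open import Data.Fin using (Fin; _<_)
open import Data.Fin.Properties using (all?; any?) renaming (_≟_ to _≟ᶠ_)
open import Data.Fin.Subset
  using (Subset; inside; outside; _∈_; _∩_; _∪_; ⊤; ⊥; ⋃; ∣_∣)
open import Data.Fin.Subset.Properties using (_∈?_; anySubset?)
open import Data.Integer as ℤ using (ℤ; 0ℤ; 1ℤ; -1ℤ)
open import Data.List
  using (List; []; _∷_; _++_; map; filter; foldr; length; allFin; upTo)
open import Data.List.Membership.DecPropositional using () renaming (_∈?_ to mem?)
open import Data.List.Membership.Propositional using () renaming (_∈_ to _∈ˡ_)
open import Data.List.Membership.Propositional.Properties using (∈-allFin)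
open import Data.List.Relation.Unary.All as All using (All; []; _∷_)
open import Data.List.Relation.Unary.AllPairs using (AllPairs; []; _∷_)
open import Data.List.Relation.Unary.Any using (here; there)
open import Data.List.Relation.Unary.Unique.Propositional using (Unique)
open import Data.Nat as ℕ using (ℕ; zero; suc)
open import Data.Product using (_×_; _,_; proj₁; proj₂; ∃; ∃₂; uncurry)
open import Data.Product.Properties using () renaming (≡-dec to ×-≡-dec)
open import Data.Sum using (_⊎_; inj₁; inj₂; [_,_]′)
open import Data.Vec using ([]; _∷_; tabulate)
open import Data.Vec.Properties using (≡-dec)
open import Function.Bundles using (_⇔_; mk⇔; Equivalence)
open import Level using (0ℓ)
open import Relation.Binary using (Rel; Decidable; DecidableEquality)
open import Relation.Binary.Construct.Closure.ReflexiveTransitive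
  using (Star; ε; _◅_; _◅◅_)
open import Relation.Binary.PropositionalEquality using (_≡_; refl)
open import Relation.Nullary using (Dec)
open import Relation.Nullary.Decidable using (does; map′; _×-dec_; _⊎-dec_; _→-dec_)

private
  variable
    n : ℕ

------------------------------------------------------------------------
-- The ring ℤ[x]

-- Lists of coefficients, constant term first.  Trailing zeros are allowed,
-- so polynomials are compared with _≈_ and not with _≡_.
Poly : Set
Poly = List ℤ

coeff : Poly → ℕ → ℤ
coeff []      _       = 0ℤ
coeff (a ∷ p) zero    = a
coeff (a ∷ p) (suc k) = coeff p k

infix 4 _≈_
_≈_ : Rel Poly 0ℓ
p ≈ q = ∀ k → coeff p k ≡ coeff q k

infixl 6 _+_
_+_ : Poly → Poly → Poly
[]      + q       = q
(a ∷ p) + []      = a ∷ p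
(a ∷ p) + (b ∷ q) = a ℤ.+ b ∷ p + q

infixl 7 _*_
_*_ : Poly → Poly → Poly
[]      * q = []
(a ∷ p) * q = map (a ℤ.*_) q + (0ℤ ∷ p * q)

const : ℤ → Poly
const a = a ∷ []

X : Poly
X = 0ℤ ∷ 1ℤ ∷ []

polyRawSemiring : RawSemiring 0ℓ 0ℓ
polyRawSemiring = record
  { Carrier = Poly
  ; _≈_     = _≈_
  ; _+_     = _+_
  ; _*_     = _*_
  ; 0#      = []
  ; 1#      = const 1ℤ
  }

open RawSemiringDefinitions polyRawSemiring public using (_^_)

∑ : {A : Set} → List A → (A → Poly) → Poly
∑ xs f = foldr (λ a p → f a + p) [] xs

∏ : {A : Set} → List A → (A → Poly) → Poly
∏ xs f = foldr (λ a p → f a * p) (const 1ℤ) xs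

sign : ℕ → Poly
sign k = const (-1ℤ ℤ.^ k)

------------------------------------------------------------------------
-- Finite sets

infix 4 _≟ˢ_
_≟ˢ_ : DecidableEquality (Subset n)
_≟ˢ_ = ≡-dec Bool._≟_

subsets : ∀ n → List (Subset n)
subsets zero    = [] ∷ []
subsets (suc n) = map (outside ∷_) (subsets n) ++ map (inside ∷_) (subsets n)

module _ {A : Set} where

  select : (xs : List A) → Subset (length xs) → List A
  select []       []            = []
  select (x ∷ xs) (inside ∷ s)  = x ∷ select xs s
  select (x ∷ xs) (outside ∷ s) = select xs s

  select-All : {P : A → Set} → ∀ {xs} → All P xs → ∀ s → All P (select xs s)
  select-All []         []            = []
  select-All (px ∷ pxs) (inside ∷ s)  = px ∷ select-All pxs s
  select-All (px ∷ pxs) (outside ∷ s) = select-All pxs s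

  select-AllPairs : {R : Rel A 0ℓ} → ∀ {xs} → AllPairs R xs →
                    ∀ s → AllPairs R (select xs s)
  select-AllPairs []         []            = []
  select-AllPairs (rx ∷ rxs) (inside ∷ s)  = select-All rx s ∷ select-AllPairs rxs s
  select-AllPairs (rx ∷ rxs) (outside ∷ s) = select-AllPairs rxs s

------------------------------------------------------------------------
-- Decidability of reachability in a decidable relation on Fin n

module Reachability {R : Rel (Fin n) 0ℓ} (R? : Decidable R) where

  -- Through us v w: there is a path from v to w whose inner vertices all
  -- belong to us (the Floyd–Warshall recursion).
  Through : List (Fin n) → Rel (Fin n) 0ℓ
  Through []       v w = v ≡ w ⊎ R v w
  Through (u ∷ us) v w = Through us v w ⊎ (Through us v u × Through us u w)

  through? : ∀ us → Decidable (Through us)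
  through? []       v w = (v ≟ᶠ w) ⊎-dec R? v w
  through? (u ∷ us) v w =
    through? us v w ⊎-dec (through? us v u ×-dec through? us u w)

  through-base : ∀ us {v w} → v ≡ w ⊎ R v w → Through us v w
  through-base []       p = p
  through-base (u ∷ us) p = inj₁ (through-base us p)

  through-trans : ∀ us {v u w} → u ∈ˡ us →
                  Through us v u → Through us u w → Through us v w
  through-trans (u ∷ us) (here refl) p q =
    inj₂ ([ (λ r → r) , proj₁ ]′ p , [ (λ r → r) , proj₂ ]′ q)
  through-trans (u ∷ us) (there i) (inj₁ p) (inj₁ q) = inj₁ (through-trans us i p q)
  through-trans (u ∷ us) (there i) (inj₁ p) (inj₂ (q , q′)) =
    inj₂ (through-trans us i p q , q′)
  through-trans (u ∷ us) (there i) (inj₂ (p , p′)) (inj₁ q) =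
    inj₂ (p , through-trans us i p′ q)
  through-trans (u ∷ us) (there i) (inj₂ (p , _)) (inj₂ (_ , q)) = inj₂ (p , q)

  sound : ∀ us {v w} → Through us v w → Star R v w
  sound []       (inj₁ refl)    = ε
  sound []       (inj₂ r)       = r ◅ ε
  sound (u ∷ us) (inj₁ p)       = sound us p
  sound (u ∷ us) (inj₂ (p , q)) = sound us p ◅◅ sound us q

  complete : ∀ {v w} → Star R v w → Through (allFin n) v w
  complete ε        = through-base (allFin n) (inj₁ refl)
  complete (r ◅ rs) =
    through-trans (allFin n) (∈-allFin _) (through-base (allFin n) (inj₂ r)) (complete rs)

  star? : Decidable (Star R)
  star? v w = map′ (sound (allFin n)) complete (through? (allFin n) v w)

------------------------------------------------------------------------
-- Graphs

-- A simple graph with vertex set Fin n.  The edge {u , v} is represented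
-- by the pair (u , v) with u < v.
record Graph (n : ℕ) : Set where
  field
    edges   : List (Fin n × Fin n)
    ordered : All (uncurry _<_) edges
    unique  : Unique edges

  Adj : Rel (Fin n) 0ℓ
  Adj u v = (u , v) ∈ˡ edges ⊎ (v , u) ∈ˡ edges

  adj? : Decidable Adj
  adj? u v = mem? (×-≡-dec _≟ᶠ_ _≟ᶠ_) (u , v) edges
       ⊎-dec mem? (×-≡-dec _≟ᶠ_ _≟ᶠ_) (v , u) edges

open Graph public

EdgeSubset : Graph n → Set
EdgeSubset G = Subset (length (edges G))

spanning : (G : Graph n) → EdgeSubset G → Graph n
spanning G B = record
  { edges   = select (edges G) B
  ; ordered = select-All (ordered G) B
  ; unique  = select-AllPairs (unique G) B
  }

------------------------------------------------------------------------
-- Domination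

N[_] : Graph n → Fin n → Subset n
N[ G ] v = tabulate λ u → does ((u ≟ᶠ v) ⊎-dec adj? G v u)

N[_]⟨_⟩ : Graph n → Subset n → Subset n
N[_]⟨_⟩ {n} G W = ⋃ (map N[ G ] (filter (_∈? W) (allFin n)))

Dominating : Graph n → Subset n → Set
Dominating G W = N[ G ]⟨ W ⟩ ≡ ⊤

dominating? : (G : Graph n) (W : Subset n) → Dec (Dominating G W)
dominating? G W = N[ G ]⟨ W ⟩ ≟ˢ ⊤

d : ℕ → Graph n → ℕ
d {n} k G =
  length (filter (λ W → dominating? G W ×-dec (∣ W ∣ ℕ.≟ k)) (subsets n))

D : Graph n → Poly
D {n} G = ∑ (upTo (suc n)) λ k → const (ℤ.+ d k G) * X ^ k

------------------------------------------------------------------------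
-- Bipartite graphs

record IsBipartition (G : Graph n) (Y Z : Subset n) : Set where
  constructor isBipartition
  field
    disjoint : Y ∩ Z ≡ ⊥
    covers   : Y ∪ Z ≡ ⊤
    crossing : All (λ (u , v) → (u ∈ Y × v ∈ Z) ⊎ (u ∈ Z × v ∈ Y)) (edges G)

Bipartite : Graph n → Set
Bipartite G = ∃₂ (IsBipartition G)

isBipartition? : (G : Graph n) (Y Z : Subset n) → Dec (IsBipartition G Y Z)
isBipartition? G Y Z =
  map′ (λ (p , q , r) → isBipartition p q r)
       (λ (isBipartition p q r) → p , q , r)
       (((Y ∩ Z) ≟ˢ ⊥) ×-dec ((Y ∪ Z) ≟ˢ ⊤) ×-dec
        All.all? (λ (u , v) → ((u ∈? Y) ×-dec (v ∈? Z)) ⊎-dec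
                              ((u ∈? Z) ×-dec (v ∈? Y)))
                 (edges G))

bipartite? : (G : Graph n) → Dec (Bipartite G)
bipartite? G = anySubset? λ Y → anySubset? λ Z → isBipartition? G Y Z

------------------------------------------------------------------------
-- Components

-- Components are given by their vertex sets: the classes of the relation
-- "joined by a path".
IsComponent : Graph n → Subset n → Set
IsComponent G C = ∃ λ v → ∀ w → w ∈ C ⇔ Star (Adj G) v w

isComponent? : (G : Graph n) (C : Subset n) → Dec (IsComponent G C)
isComponent? G C = any? λ v → all? λ w →
  map′ (uncurry mk⇔) (λ e → Equivalence.to e , Equivalence.from e)
       (((w ∈? C) →-dec star? v w) ×-dec (star? v w →-dec (w ∈? C)))
  where open Reachability (adj? G)

components : Graph n → List (Subset n)
components {n} G = filter (isComponent? G) (subsets n)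

edgesWithin : Graph n → Subset n → List (Fin n × Fin n)
edgesWithin G C = filter (λ (u , v) → (u ∈? C) ×-dec (v ∈? C)) (edges G)

nontrivialComponents : Graph n → List (Subset n)
nontrivialComponents G =
  filter (λ C → 1 ℕ.≤? length (edgesWithin G C)) (components G)

-- A simple graph is isomorphic to K₁ iff it has exactly one vertex.
isolatedComponents : Graph n → List (Subset n)
isolatedComponents G = filter (λ C → ∣ C ∣ ℕ.≟ 1) (components G)

------------------------------------------------------------------------
-- The summand h(B), as a function of H = (V , B) and its bipartition

h : Graph n → (Y Z : Subset n) → Poly
h H Y Z =
  X ^ length (isolatedComponents H) *
  ∏ (nontrivialComponents H) λ C →
    sign (length (edgesWithin H C)) *
    (sign ∣ Y ∩ C ∣ * X ^ ∣ Z ∩ C ∣ + sign ∣ Z ∩ C ∣ * X ^ ∣ Y ∩ C ∣)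

bipartiteSubsets : (G : Graph n) → List (EdgeSubset G)
bipartiteSubsets G =
  filter (λ B → bipartite? (spanning G B)) (subsets (length (edges G)))

{-# OPTIONS --safe #-}

-- Inclusion–exclusion over the vertices that W fails to dominate writes the indicator of "W is
-- dominating" as the sum of (−1)^|U| over the sets U disjoint from W with no edge of G joining
-- U to W.  Expanding the condition on the edges as the product over E of 1 − [e joins U and W]
-- gives, after exchanging the sums, D(G,x) = Σ_B (−1)^|B| Σ (−1)^|U| x^|W|, the inner sum being
-- over the disjoint pairs (W, U) such that every edge of B joins U to W.  For fixed B it
-- factorises over the components of (V, B).  An isolated vertex may lie in W, in U or in
-- neither and contributes x − 1 + 1 = x; on a component with an edge the pair is a bipartition,
-- so it is one of the two orderings of the given one, or there is no pair at all if (V, B) is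
-- not bipartite.

module Submission where

open import Algebra.Bundles using (CommutativeMonoid; CommutativeRing; RawRing; Semiring)
import Algebra.Construct.Pointwise as Pointwise
import Algebra.Definitions.RawSemiring as RawSemiringDefinitions
import Algebra.Morphism.RingMonomorphism as RingMonomorphism
open import Algebra.Morphism.Structures using (IsRingMonomorphism)
import Algebra.Properties.CommutativeSemigroup as CommutativeSemigroupProperties
open import Algebra.Structures using (IsCommutativeRing)
open import Data.Bool using (Bool; true; false; if_then_else_; not; _∧_)
import Data.Bool.Properties as Bool
open import Data.Fin using (Fin; zero; suc)
import Data.Fin.Properties as Fin
open import Data.Fin.Subset using (Subset; inside; outside; _∈_; _∉_; _∩_; ∣_∣; ⋃; ⁅_⁆; ∁)
open import Data.Fin.Subset.Properties
  using ( _∈?_; ⊆-antisym; x∈⁅x⁆; x∈⁅y⁆⇒x≡y; ∣⁅x⁆∣≡1; ∣p∣≤n; ∉⊥; ∈⊤; ⊆⊤; x∈p∩q⁺; x∈p∪q⁻; x∈p∪q⁺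
        ; x∉p⇒x∈∁p; ∩-comm; ∪-comm; ∩-idem; ∩-inverseʳ; ∪-inverseʳ)
open import Data.Integer as ℤ using (ℤ; 0ℤ; 1ℤ; -1ℤ)
import Data.Integer.Properties as ℤ
open import Data.Integer.Tactic.RingSolver using (solve-∀)
open import Data.List
  using (List; []; _∷_; _++_; [_]; map; filter; foldr; concat; length; allFin; upTo)
open import Data.List.Membership.Propositional
  using (lose; find) renaming (_∈_ to _∈ˡ_; _∉_ to _∉ˡ_)
open import Data.List.Membership.Propositional.Properties
  using ( ∈-concat⁺; ∈-concat⁻′; ∈-filter⁺; ∈-filter⁻; ∈-map⁺; ∈-map⁻; ∈-++⁺ˡ; ∈-++⁺ʳ; ∈-allFin
        ; ∈-upTo⁺; ∈-length)
open import Data.List.Membership.Propositional.Properties.WithK using (unique∧set⇒bag)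
open import Data.List.Properties using (map-tabulate; concat-map-[_])
open import Data.List.Relation.Binary.BagAndSetEquality using (∼bag⇒↭)
open import Data.List.Relation.Binary.Permutation.Propositional using (_↭_)
open import Data.List.Relation.Unary.All as All using (All; []; _∷_)
import Data.List.Relation.Unary.All.Properties as All
open import Data.List.Relation.Unary.AllPairs as AllPairs using (AllPairs; []; _∷_)
import Data.List.Relation.Unary.AllPairs.Properties as AllPairs
open import Data.List.Relation.Unary.Any as Any using (Any; here; there)
import Data.List.Relation.Unary.Any.Properties as Any
open import Data.List.Relation.Unary.Unique.Propositional using (Unique)
import Data.List.Relation.Unary.Unique.Propositional.Properties as Unique
open import Data.Nat as ℕ using (ℕ; zero; suc; s≤s)
import Data.Nat.Properties as ℕ
open import Data.Product using (_×_; _,_; proj₁; proj₂; ∃)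
open import Data.Product.Properties using () renaming (≡-dec to ×-≡-dec)
open import Data.Sum as Sum using (_⊎_; inj₁; inj₂; [_,_]′)
open import Data.Vec as Vec using (Vec; []; _∷_; lookup; zip; _[_]≔_)
open import Data.Vec.Properties
  using ( []≔-commutes; lookup∘update; lookup∘update′; lookup⇒[]=; []=⇒lookup; lookup∘tabulate
        ; lookup-zip; lookup-zipWith; lookup-map; ∷-injectiveʳ)
open import Function using (_∘_; mk⇔; Equivalence)
open import Level using (0ℓ)
open import Relation.Binary using (DecidableEquality)
open import Relation.Binary.Construct.Closure.ReflexiveTransitive using (Star; _◅_; _◅◅_; reverse)
open import Relation.Binary.PropositionalEquality as ≡
  using (_≡_; _≢_; _≗_; cong; cong₂; subst)
open import Relation.Nullary using (¬_; yes; no; does; Dec; contradiction)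
open import Relation.Nullary.Decidable
  using (decidable-stable; dec-true; dec-false; _×-dec_; _⊎-dec_)
open import Relation.Unary using (Decidable)

open import Defs hiding (_≈_; _+_; _*_; _^_; ∑; ∏)

-- The factorisation over components is the step that shapes the proof: a double sum over
-- `subsets n` runs through the vertices in the fixed order of `Fin n`, while the components of (V,
-- B) interleave in that order. The pair (W, U) is therefore read as a labelling of the vertices,
-- and the double sum becomes an iterated sum with one summation variable per vertex, which may be
-- reordered and cut along any partition of the vertices. For this the summand must be a product of
-- local factors. Disjointness of W and U becomes local once the label `(true , true)` gets weight
-- 0; then vertices contribute `wt`, edges contribute `κ`, and each factor belongs to exactly one
-- component. Pairs that meet still occur in the sums, so the identities must hold for them too:
-- their terms in the inclusion-exclusion sum vanish because a vertex of W dominates itself. All of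
-- this takes place in an arbitrary commutative ring with a chosen element x; ℤ[x] enters only at
-- the end, through its ring laws and the element `X`.

private
  variable
    n : ℕ
    A B I L : Set

-- Lists and finite sums

-- Duplicate-free lists with the same elements are permutations of each other; disjointness of the
-- classes makes the right-hand side duplicate-free. This regroups vertices and edges by component.
partition-↭ :
  {P : I → A → Set} (P? : ∀ i → Decidable (P i)) (is : List I) {xs : List A} → Unique xs →
  AllPairs (λ i j → ∀ {a} → P i a → ¬ P j a) is →
  (∀ {a} → a ∈ˡ xs → Any (λ i → P i a) is) →
  xs ↭ concat (map (λ i → filter (P? i) xs) is)
partition-↭ P? is {xs} unique-xs disjoint cover =
  ∼bag⇒↭ (unique∧set⇒bag unique-xs unique-parts (mk⇔ to from))
  where
  part = λ i → filter (P? i) xs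

  unique-parts : Unique (concat (map part is))
  unique-parts = Unique.concat⁺
    (All.map⁺ (All.universal (λ i → Unique.filter⁺ (P? i) unique-xs) is))
    (AllPairs.map⁺ (AllPairs.map
      (λ {i} {j} ¬both {_} (a∈i , a∈j) →
        ¬both (proj₂ (∈-filter⁻ (P? i) {xs = xs} a∈i)) (proj₂ (∈-filter⁻ (P? j) {xs = xs} a∈j)))
      disjoint))

  to : ∀ {a} → a ∈ˡ xs → a ∈ˡ concat (map part is)
  to a∈xs = ∈-concat⁺ (Any.map⁺ (Any.map (λ {i} → ∈-filter⁺ (P? i) a∈xs) (cover a∈xs)))

  from : ∀ {a} → a ∈ˡ concat (map part is) → a ∈ˡ xs
  from a∈parts with _ , a∈part , part∈ ← ∈-concat⁻′ (map part is) a∈parts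
               with i , _ , ≡.refl ← ∈-map⁻ part part∈ = proj₁ (∈-filter⁻ (P? i) {xs = xs} a∈part)

allPairs-distinct : {P : A → Set} {Q : A → A → Set} →
  (∀ {a b} → P a → P b → a ≢ b → Q a b) →
  ∀ {xs} → All P xs → Unique xs → AllPairs Q xs
allPairs-distinct q []         []            = []
allPairs-distinct q (pa ∷ pas) (a∉xs ∷ uniq) =
  All.zipWith (λ (pb , a≢b) → q pa pb a≢b) (pas , a∉xs) ∷ allPairs-distinct q pas uniq

module BigOp (M : CommutativeMonoid 0ℓ 0ℓ) where
  open CommutativeMonoid M
  open CommutativeSemigroupProperties commutativeSemigroup using (interchange; x∙yz≈y∙xz)

  fold : List A → (A → Carrier) → Carrier
  fold xs f = foldr (λ a p → f a ∙ p) ε xs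

  fold-cong : ∀ (xs : List A) {f g} → (∀ {a} → a ∈ˡ xs → f a ≈ g a) → fold xs f ≈ fold xs g
  fold-cong []       f≈g = refl
  fold-cong (a ∷ xs) f≈g = ∙-cong (f≈g (here ≡.refl)) (fold-cong xs (f≈g ∘ there))

  fold-ε : ∀ (xs : List A) {f} → (∀ {a} → a ∈ˡ xs → f a ≈ ε) → fold xs f ≈ ε
  fold-ε []       f≈ε = refl
  fold-ε (a ∷ xs) f≈ε =
    trans (∙-cong (f≈ε (here ≡.refl)) (fold-ε xs (f≈ε ∘ there))) (identityˡ ε)

  fold-∙ : ∀ (xs : List A) f g → fold xs (λ a → f a ∙ g a) ≈ fold xs f ∙ fold xs g
  fold-∙ []       f g = sym (identityˡ ε)
  fold-∙ (a ∷ xs) f g = trans (∙-congˡ (fold-∙ xs f g)) (interchange (f a) (g a) _ _)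

  fold-swap : ∀ (xs : List A) (ys : List B) (f : A → B → Carrier) →
    fold xs (λ a → fold ys (f a)) ≈ fold ys (λ b → fold xs λ a → f a b)
  fold-swap []       ys f = sym (fold-ε ys λ _ → refl)
  fold-swap (a ∷ xs) ys f =
    trans (∙-congˡ (fold-swap xs ys f)) (sym (fold-∙ ys (f a) _))

  fold-map : ∀ (g : B → A) xs f → fold (map g xs) f ≡ fold xs (f ∘ g)
  fold-map g []       f = ≡.refl
  fold-map g (a ∷ xs) f = cong (f (g a) ∙_) (fold-map g xs f)

  fold-++ : ∀ (xs ys : List A) f → fold (xs ++ ys) f ≈ fold xs f ∙ fold ys f
  fold-++ []       ys f = sym (identityˡ _)
  fold-++ (a ∷ xs) ys f = trans (∙-congˡ (fold-++ xs ys f)) (sym (assoc (f a) _ _))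

  fold-concat : ∀ (g : I → List A) is f →
    fold (concat (map g is)) f ≈ fold is (λ i → fold (g i) f)
  fold-concat g []       f = refl
  fold-concat g (i ∷ is) f = trans (fold-++ (g i) _ f) (∙-congˡ (fold-concat g is f))

  fold-↭ : ∀ {xs ys : List A} f → xs ↭ ys → fold xs f ≈ fold ys f
  fold-↭ f _↭_.refl         = refl
  fold-↭ f (_↭_.prep a p)   = ∙-congˡ (fold-↭ f p)
  fold-↭ f (_↭_.swap a b p) =
    trans (∙-congˡ (∙-congˡ (fold-↭ f p))) (x∙yz≈y∙xz (f a) (f b) _)
  fold-↭ f (_↭_.trans p q)  = trans (fold-↭ f p) (fold-↭ f q)

  fold-filter : ∀ {P : A → Set} (P? : Decidable P) xs f →
    fold (filter P? xs) f ≈ fold xs (λ a → if does (P? a) then f a else ε)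
  fold-filter P? []       f = refl
  fold-filter P? (a ∷ xs) f with does (P? a)
  ... | true  = ∙-congˡ (fold-filter P? xs f)
  ... | false = trans (fold-filter P? xs f) (sym (identityˡ _))

  fold-allFin : ∀ n f → fold (allFin (suc n)) f ≡ f zero ∙ fold (allFin n) (f ∘ suc)
  fold-allFin n f = cong (f zero ∙_)
    (≡.trans (cong (λ vs → fold vs f) (≡.sym (map-tabulate (λ i → i) suc)))
             (fold-map suc (allFin n) f))

  fold-subsets : ∀ n f → fold (subsets (suc n)) f ≈
    fold (subsets n) (f ∘ (outside ∷_)) ∙ fold (subsets n) (f ∘ (inside ∷_))
  fold-subsets n f = trans (fold-++ (map (outside ∷_) (subsets n)) _ f)
    (reflexive (cong₂ _∙_ (fold-map (outside ∷_) (subsets n) f)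
                          (fold-map (inside ∷_) (subsets n) f)))

module RingSums (R : CommutativeRing 0ℓ 0ℓ) where
  open CommutativeRing R hiding (zero)
  open RawSemiringDefinitions (Semiring.rawSemiring semiring) using (_^_)
  open BigOp +-commutativeMonoid public using () renaming
    ( fold to ∑; fold-cong to ∑-cong; fold-ε to ∑-zero; fold-∙ to ∑-+; fold-swap to ∑-swap
    ; fold-filter to ∑-filter; fold-subsets to ∑-subsets)
  open BigOp *-commutativeMonoid public using () renaming
    ( fold to ∏; fold-cong to ∏-cong; fold-ε to ∏-one; fold-∙ to ∏-*; fold-concat to ∏-concat
    ; fold-↭ to ∏-↭; fold-filter to ∏-filter; fold-allFin to ∏-allFin)
  open import Relation.Binary.Reasoning.Setoid setoid

  ∑-*ˡ : ∀ c (xs : List A) f → c * ∑ xs f ≈ ∑ xs (λ a → c * f a)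
  ∑-*ˡ c []       f = zeroʳ c
  ∑-*ˡ c (a ∷ xs) f = trans (distribˡ c (f a) _) (+-congˡ (∑-*ˡ c xs f))

  ∑-*ʳ : ∀ c (xs : List A) f → ∑ xs f * c ≈ ∑ xs (λ a → f a * c)
  ∑-*ʳ c []       f = zeroˡ c
  ∑-*ʳ c (a ∷ xs) f = trans (distribʳ c (f a) _) (+-congˡ (∑-*ʳ c xs f))

  ∏-zero : ∀ {xs : List A} {f a} → a ∈ˡ xs → f a ≈ 0# → ∏ xs f ≈ 0#
  ∏-zero (here ≡.refl) fa≈0 = trans (*-congʳ fa≈0) (zeroˡ _)
  ∏-zero (there a∈xs)  fa≈0 = trans (*-congˡ (∏-zero a∈xs fa≈0)) (zeroʳ _)

  ∏-const : ∀ c (xs : List A) → ∏ xs (λ _ → c) ≡ c ^ length xs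
  ∏-const c []       = ≡.refl
  ∏-const c (_ ∷ xs) = cong (c *_) (∏-const c xs)

  -- Turns a power whose exponent is a cardinality into one local factor per vertex.
  ∏-subset : ∀ c (S : Subset n) → ∏ (allFin n) (λ v → if lookup S v then c else 1#) ≈ c ^ ∣ S ∣
  ∏-subset c []            = refl
  ∏-subset {suc n} c (inside ∷ S)  = trans
    (reflexive (∏-allFin n λ v → if lookup (inside ∷ S) v then c else 1#))
    (*-congˡ (∏-subset c S))
  ∏-subset {suc n} c (outside ∷ S) = trans
    (reflexive (∏-allFin n λ v → if lookup (outside ∷ S) v then c else 1#))
    (trans (*-identityˡ _) (∏-subset c S))

  -- Expansion of a product of binomials: U collects the vertices at which `g v` is chosen over
  -- `1#`. With `g = undominated W` this is the inclusion-exclusion step.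
  ∏-1+-lookup : ∀ (g : Fin n → Carrier) →
    ∏ (allFin n) (λ v → 1# + g v) ≈
    ∑ (subsets n) (λ U → ∏ (allFin n) λ v → if lookup U v then g v else 1#)
  ∏-1+-lookup {zero}  g = sym (+-identityʳ 1#)
  ∏-1+-lookup {suc n} g = begin
    ∏ (allFin (suc n)) (λ v → 1# + g v)
      ≡⟨ ∏-allFin n _ ⟩
    (1# + g zero) * ∏ (allFin n) (λ v → 1# + g (suc v))
      ≈⟨ *-congˡ (∏-1+-lookup (g ∘ suc)) ⟩
    (1# + g zero) * ∑ (subsets n) factor
      ≈⟨ distribʳ _ _ _ ⟩
    1# * ∑ (subsets n) factor + g zero * ∑ (subsets n) factor
      ≈⟨ +-cong (∑-*ˡ 1# (subsets n) factor) (∑-*ˡ (g zero) (subsets n) factor) ⟩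
    ∑ (subsets n) (λ U → 1# * factor U) + ∑ (subsets n) (λ U → g zero * factor U)
      ≈⟨ +-cong (∑-cong (subsets n) λ {U} _ → reflexive (≡.sym (∏-allFin n _)))
                (∑-cong (subsets n) λ {U} _ → reflexive (≡.sym (∏-allFin n _))) ⟩
    ∑ (subsets n) (factor′ ∘ (outside ∷_)) + ∑ (subsets n) (factor′ ∘ (inside ∷_))
      ≈⟨ ∑-subsets n factor′ ⟨
    ∑ (subsets (suc n)) factor′ ∎
    where
    factor : Subset n → Carrier
    factor U = ∏ (allFin n) λ v → if lookup U v then g (suc v) else 1#
    factor′ : Subset (suc n) → Carrier
    factor′ U = ∏ (allFin (suc n)) λ v → if lookup U v then g v else 1#

  -- The same expansion indexed by positions in a list, so that over `edges G` the index B is an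
  -- `EdgeSubset`.
  ∏-1+-select : ∀ (xs : List A) g →
    ∏ xs (λ a → 1# + g a) ≈ ∑ (subsets (length xs)) (λ B → ∏ (select xs B) g)
  ∏-1+-select []       g = sym (+-identityʳ 1#)
  ∏-1+-select (a ∷ xs) g = begin
    (1# + g a) * ∏ xs (λ b → 1# + g b)
      ≈⟨ *-congˡ (∏-1+-select xs g) ⟩
    (1# + g a) * ∑ Bs factor
      ≈⟨ distribʳ _ _ _ ⟩
    1# * ∑ Bs factor + g a * ∑ Bs factor
      ≈⟨ +-cong (*-identityˡ _) (∑-*ˡ (g a) Bs factor) ⟩
    ∑ Bs factor + ∑ Bs (λ B → g a * factor B)
      ≈⟨ ∑-subsets (length xs) _ ⟨
    ∑ (subsets (suc (length xs))) (λ B → ∏ (select (a ∷ xs) B) g) ∎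
    where
    Bs = subsets (length xs)
    factor : Subset (length xs) → Carrier
    factor B = ∏ (select xs B) g

-- ∑ᴸ vs f φ sums φ over all relabellings of f on vs.  Off vs the labels are those of f, so that a
-- sum over all labellings can be split along a partition of the vertices.
module LabellingSums (R : CommutativeRing 0ℓ 0ℓ) {L : Set} (labels : List L) where
  open CommutativeRing R hiding (zero)
  open RingSums R
  open import Relation.Binary.Reasoning.Setoid setoid

  ∑ᴸ : List (Fin n) → Vec L n → (Vec L n → Carrier) → Carrier
  ∑ᴸ []       f φ = φ f
  ∑ᴸ (v ∷ vs) f φ = ∑ labels λ c → ∑ᴸ vs (f [ v ]≔ c) φ

  ∑ᴸ-cong : ∀ (vs : List (Fin n)) f {φ ψ : Vec L n → Carrier} →
    (∀ g → φ g ≈ ψ g) → ∑ᴸ vs f φ ≈ ∑ᴸ vs f ψ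
  ∑ᴸ-cong []       f φ≈ψ = φ≈ψ f
  ∑ᴸ-cong (v ∷ vs) f φ≈ψ = ∑-cong labels λ {c} _ → ∑ᴸ-cong vs (f [ v ]≔ c) φ≈ψ

  ∑ᴸ-zero : ∀ (vs : List (Fin n)) f → ∑ᴸ vs f (λ _ → 0#) ≈ 0#
  ∑ᴸ-zero []       f = refl
  ∑ᴸ-zero (v ∷ vs) f = ∑-zero labels λ {c} _ → ∑ᴸ-zero vs (f [ v ]≔ c)

  ∑ᴸ-+ : ∀ (vs : List (Fin n)) f φ ψ → ∑ᴸ vs f (λ g → φ g + ψ g) ≈ ∑ᴸ vs f φ + ∑ᴸ vs f ψ
  ∑ᴸ-+ []       f φ ψ = refl
  ∑ᴸ-+ (v ∷ vs) f φ ψ =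
    trans (∑-cong labels λ {c} _ → ∑ᴸ-+ vs (f [ v ]≔ c) φ ψ) (∑-+ labels _ _)

  ∑ᴸ-++ : ∀ (us vs : List (Fin n)) f φ → ∑ᴸ (us ++ vs) f φ ≈ ∑ᴸ us f (λ g → ∑ᴸ vs g φ)
  ∑ᴸ-++ []       vs f φ = refl
  ∑ᴸ-++ (u ∷ us) vs f φ = ∑-cong labels λ {c} _ → ∑ᴸ-++ us vs (f [ u ]≔ c) φ

  ∑ᴸ-↭ : ∀ {us vs : List (Fin n)} f φ → us ↭ vs → ∑ᴸ us f φ ≈ ∑ᴸ vs f φ
  ∑ᴸ-↭ f φ _↭_.refl        = refl
  ∑ᴸ-↭ f φ (_↭_.prep v p)  = ∑-cong labels λ {c} _ → ∑ᴸ-↭ (f [ v ]≔ c) φ p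
  ∑ᴸ-↭ f φ (_↭_.trans p q) = trans (∑ᴸ-↭ f φ p) (∑ᴸ-↭ f φ q)
  ∑ᴸ-↭ {vs = _ ∷ _ ∷ vs} f φ (_↭_.swap u v p) with u Fin.≟ v
  -- Two updates at the same vertex do not commute, but then both lists begin with the same two
  -- vertices and nothing has to be exchanged.
  ... | yes ≡.refl = ∑-cong labels λ _ → ∑-cong labels λ _ → ∑ᴸ-↭ _ φ p
  ... | no u≢v     = trans
    (∑-cong labels λ {c} _ → ∑-cong labels λ {c′} _ →
      trans (∑ᴸ-↭ _ φ p) (reflexive (cong (λ g → ∑ᴸ vs g φ) ([]≔-commutes f u v u≢v))))
    (∑-swap labels labels λ c c′ → ∑ᴸ vs (f [ v ]≔ c′ [ u ]≔ c) φ)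

  ∑ᴸ-*ˡ : ∀ (vs : List (Fin n)) f {φ ψ : Vec L n → Carrier} →
    (∀ g {v} c → v ∈ˡ vs → φ (g [ v ]≔ c) ≈ φ g) →
    ∑ᴸ vs f (λ g → φ g * ψ g) ≈ φ f * ∑ᴸ vs f ψ
  ∑ᴸ-*ˡ []       f inv = refl
  ∑ᴸ-*ˡ (v ∷ vs) f {φ} {ψ} inv = trans
    (∑-cong labels λ {c} _ → trans
      (∑ᴸ-*ˡ vs (f [ v ]≔ c) {φ = φ} {ψ = ψ} (λ g c′ → inv g c′ ∘ there))
      (*-congʳ (inv f c (here ≡.refl))))
    (sym (∑-*ˡ _ labels _))

  DependsOn : List (Fin n) → (Vec L n → Carrier) → Set
  DependsOn vs φ = ∀ f g → (∀ {v} → v ∈ˡ vs → lookup f v ≡ lookup g v) → φ f ≈ φ g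

  -- Invariant: each vertex that φ looks at is still to be overwritten or already labelled alike,
  -- and every update moves its vertex to the second case. With `us` equal to `vs`, the sum does not
  -- see the starting labelling.
  ∑ᴸ-base : ∀ {us} {φ : Vec L n → Carrier} → DependsOn us φ → ∀ vs f g →
    (∀ {v} → v ∈ˡ us → v ∈ˡ vs ⊎ lookup f v ≡ lookup g v) → ∑ᴸ vs f φ ≈ ∑ᴸ vs g φ
  ∑ᴸ-base dep [] f g agree = dep f g λ v∈us → case (agree v∈us)
    where
    case : ∀ {v} → v ∈ˡ [] ⊎ lookup f v ≡ lookup g v → lookup f v ≡ lookup g v
    case (inj₂ eq) = eq
  ∑ᴸ-base {us = us} dep (w ∷ vs) f g agree =
    ∑-cong labels λ {c} _ → ∑ᴸ-base dep vs (f [ w ]≔ c) (g [ w ]≔ c) (step c)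
    where
    step : ∀ c {v} → v ∈ˡ us →
      v ∈ˡ vs ⊎ lookup (f [ w ]≔ c) v ≡ lookup (g [ w ]≔ c) v
    step c {v} v∈us with v Fin.≟ w | agree v∈us
    ... | yes ≡.refl | _ = inj₂ (≡.trans (lookup∘update v f c) (≡.sym (lookup∘update v g c)))
    ... | no v≢w | inj₁ (here v≡w)   = contradiction v≡w v≢w
    ... | no v≢w | inj₁ (there v∈vs) = inj₁ v∈vs
    ... | no v≢w | inj₂ eq = inj₂ (≡.trans (lookup∘update′ v≢w f c)
                                  (≡.trans eq (≡.sym (lookup∘update′ v≢w g c))))

  -- Distributive law for sums over disjoint blocks. Relabelling the later blocks leaves the first
  -- factor unchanged, so it comes out of their sums; these in turn do not depend on the labels
  -- given to the first block.
  ∑ᴸ-blocks : (m : I → List (Fin n)) (φ : I → Vec L n → Carrier) →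
    (∀ i → DependsOn (m i) (φ i)) → ∀ f {is} →
    AllPairs (λ i j → ∀ {v} → v ∈ˡ m i → v ∉ˡ m j) is →
    ∑ᴸ (concat (map m is)) f (λ g → ∏ is λ i → φ i g) ≈ ∏ is λ i → ∑ᴸ (m i) f (φ i)
  ∑ᴸ-blocks m φ dep f []                            = refl
  ∑ᴸ-blocks m φ dep f {i ∷ is} (disjoint ∷ disjoints) = begin
    ∑ᴸ (m i ++ rest) f (λ g → φ i g * Φ g)
      ≈⟨ ∑ᴸ-++ (m i) rest f _ ⟩
    ∑ᴸ (m i) f (λ g → ∑ᴸ rest g λ g′ → φ i g′ * Φ g′)
      ≈⟨ ∑ᴸ-cong (m i) f (λ g → ∑ᴸ-*ˡ rest g {φ = φ i} {ψ = Φ} λ g′ c v∈ → dep i _ _ λ u∈ →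
           lookup∘update′ (λ { ≡.refl → rest-disjoint v∈ u∈ }) g′ c) ⟩
    ∑ᴸ (m i) f (λ g → φ i g * ∑ᴸ rest g Φ)
      ≈⟨ ∑ᴸ-cong (m i) f (λ g → *-congˡ (∑ᴸ-blocks m φ dep g disjoints)) ⟩
    ∑ᴸ (m i) f (λ g → φ i g * ∏ is λ j → ∑ᴸ (m j) g (φ j))
      ≈⟨ ∑ᴸ-cong (m i) f (λ g → trans
           (*-congˡ (∏-cong is λ {j} _ → ∑ᴸ-base (dep j) (m j) g f inj₁)) (*-comm _ _)) ⟩
    ∑ᴸ (m i) f (λ g → (∏ is λ j → ∑ᴸ (m j) f (φ j)) * φ i g)
      ≈⟨ ∑ᴸ-*ˡ (m i) f {φ = λ _ → ∏ is λ j → ∑ᴸ (m j) f (φ j)} {ψ = φ i} (λ _ _ _ → refl) ⟩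
    (∏ is λ j → ∑ᴸ (m j) f (φ j)) * ∑ᴸ (m i) f (φ i)
      ≈⟨ *-comm _ _ ⟩
    ∑ᴸ (m i) f (φ i) * (∏ is λ j → ∑ᴸ (m j) f (φ j)) ∎
    where
    rest = concat (map m is)
    Φ = λ g → ∏ is λ j → φ j g
    rest-disjoint : ∀ {v} → v ∈ˡ rest → v ∉ˡ m i
    rest-disjoint v∈rest v∈i with _ , v∈ys , ys∈ ← ∈-concat⁻′ (map m is) v∈rest
                             with j , j∈is , ≡.refl ← ∈-map⁻ m ys∈ =
      All.lookup disjoint j∈is v∈i v∈ys

  -- The case of one-vertex blocks.
  ∑ᴸ-∏ : ∀ (ψ : Fin n → L → Carrier) f {vs} → Unique vs →
    ∑ᴸ vs f (λ g → ∏ vs λ v → ψ v (lookup g v)) ≈ ∏ vs λ v → ∑ labels (ψ v)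
  ∑ᴸ-∏ ψ f {vs} uniq = begin
    ∑ᴸ vs f (λ g → ∏ vs λ v → ψ v (lookup g v))
      ≡⟨ cong (λ us → ∑ᴸ us f (λ g → ∏ vs λ v → ψ v (lookup g v))) (concat-map-[_] vs) ⟨
    ∑ᴸ (concat (map [_] vs)) f (λ g → ∏ vs λ v → ψ v (lookup g v))
      ≈⟨ ∑ᴸ-blocks [_] (λ v g → ψ v (lookup g v))
           (λ v f g eq → reflexive (cong (ψ v) (eq (here ≡.refl)))) f
           (AllPairs.map (λ { u≢v (here ≡.refl) (here u≡v) → u≢v u≡v }) uniq) ⟩
    (∏ vs λ v → ∑ labels λ c → ψ v (lookup (f [ v ]≔ c) v))
      ≈⟨ ∏-cong vs (λ {v} _ → ∑-cong labels λ {c} _ →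
           reflexive (cong (ψ v) (lookup∘update v f c))) ⟩
    (∏ vs λ v → ∑ labels (ψ v)) ∎

  ∑ᴸ-map-suc : ∀ (vs : List (Fin n)) c f φ → ∑ᴸ (map suc vs) (c ∷ f) φ ≈ ∑ᴸ vs f (φ ∘ (c ∷_))
  ∑ᴸ-map-suc []       c f φ = refl
  ∑ᴸ-map-suc (v ∷ vs) c f φ = ∑-cong labels λ {c′} _ → ∑ᴸ-map-suc vs c (f [ v ]≔ c′) φ

  ∑ᴸ-allFin : ∀ c (f : Vec L n) φ →
    ∑ᴸ (allFin (suc n)) (c ∷ f) φ ≈ ∑ labels λ c′ → ∑ᴸ (allFin n) f (φ ∘ (c′ ∷_))
  ∑ᴸ-allFin {n} c f φ = ∑-cong labels λ {c′} _ → trans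
    (reflexive (cong (λ vs → ∑ᴸ vs (c′ ∷ f) φ) (≡.sym (map-tabulate (λ i → i) suc))))
    (∑ᴸ-map-suc (allFin n) c′ f φ)

-- Finite sets, neighbourhoods and components

∈-subsets : ∀ (S : Subset n) → S ∈ˡ subsets n
∈-subsets []            = here ≡.refl
∈-subsets (outside ∷ S) = ∈-++⁺ˡ (∈-map⁺ (outside ∷_) (∈-subsets S))
∈-subsets (inside ∷ S)  = ∈-++⁺ʳ _ (∈-map⁺ (inside ∷_) (∈-subsets S))

subsets-unique : ∀ n → Unique (subsets n)
subsets-unique zero    = [] ∷ []
subsets-unique (suc n) = Unique.++⁺
  (Unique.map⁺ ∷-injectiveʳ (subsets-unique n)) (Unique.map⁺ ∷-injectiveʳ (subsets-unique n))
  disjoint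
  where
  disjoint : ∀ {S} → ¬ (S ∈ˡ map (outside ∷_) (subsets n) × S ∈ˡ map (inside ∷_) (subsets n))
  disjoint (S∈ , S∈′) with _ , _ , ≡.refl ← ∈-map⁻ (outside ∷_) S∈
                      with () ← ∈-map⁻ (inside ∷_) S∈′ .proj₂ .proj₂

∉⇒lookup : ∀ {S : Subset n} {v} → v ∉ S → lookup S v ≡ outside
∉⇒lookup {S = S} {v} v∉S = Bool.¬-not (v∉S ∘ lookup⇒[]= v S)

lookup⇒∉ : ∀ {S : Subset n} {v} → lookup S v ≡ outside → v ∉ S
lookup⇒∉ eq v∈S with () ← ≡.trans (≡.sym eq) ([]=⇒lookup v∈S)

does-∈? : ∀ v (S : Subset n) → does (v ∈? S) ≡ lookup S v
does-∈? v S with v ∈? S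
... | yes v∈S = ≡.sym ([]=⇒lookup v∈S)
... | no v∉S  = ≡.sym (∉⇒lookup v∉S)

∈-tabulate⁺ : ∀ {P : Fin n → Set} (P? : Decidable P) {v} → P v → v ∈ Vec.tabulate (does ∘ P?)
∈-tabulate⁺ P? {v} p = lookup⇒[]= v _ (≡.trans (lookup∘tabulate (does ∘ P?) v) (dec-true (P? v) p))

∈-tabulate⁻ : ∀ {P : Fin n → Set} (P? : Decidable P) {v} → v ∈ Vec.tabulate (does ∘ P?) → P v
∈-tabulate⁻ P? {v} v∈ = decidable-stable (P? v) λ ¬p → contradiction
  (≡.trans (≡.sym ([]=⇒lookup v∈))
    (≡.trans (lookup∘tabulate (does ∘ P?) v) (dec-false (P? v) ¬p))) λ ()

∈-⋃⁺ : ∀ {v : Fin n} {S Ss} → v ∈ S → S ∈ˡ Ss → v ∈ ⋃ Ss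
∈-⋃⁺ v∈S (here ≡.refl) = x∈p∪q⁺ (inj₁ v∈S)
∈-⋃⁺ v∈S (there S∈)    = x∈p∪q⁺ (inj₂ (∈-⋃⁺ v∈S S∈))

∈-⋃⁻ : ∀ {v : Fin n} Ss → v ∈ ⋃ Ss → ∃ λ S → S ∈ˡ Ss × v ∈ S
∈-⋃⁻ []       v∈ = contradiction v∈ ∉⊥
∈-⋃⁻ (S ∷ Ss) v∈ with x∈p∪q⁻ S (⋃ Ss) v∈
... | inj₁ v∈S  = S , here ≡.refl , v∈S
... | inj₂ v∈⋃ with T , T∈ , v∈T ← ∈-⋃⁻ Ss v∈⋃ = T , there T∈ , v∈T

∣S∣≡0⇒∉ : ∀ {S : Subset n} {v} → ∣ S ∣ ≡ 0 → v ∉ S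
∣S∣≡0⇒∉ {S = outside ∷ S} eq (Vec.there v∈S) = ∣S∣≡0⇒∉ eq v∈S

∣S∣≡1⇒≡ : ∀ {S : Subset n} {u v} → ∣ S ∣ ≡ 1 → u ∈ S → v ∈ S → u ≡ v
∣S∣≡1⇒≡ {S = inside ∷ S}  eq Vec.here Vec.here = ≡.refl
∣S∣≡1⇒≡ {S = inside ∷ S}  eq (Vec.there u∈) _  =
  contradiction u∈ (∣S∣≡0⇒∉ (ℕ.suc-injective eq))
∣S∣≡1⇒≡ {S = inside ∷ S}  eq _ (Vec.there v∈)  =
  contradiction v∈ (∣S∣≡0⇒∉ (ℕ.suc-injective eq))
∣S∣≡1⇒≡ {S = outside ∷ S} eq (Vec.there u∈) (Vec.there v∈) = cong suc (∣S∣≡1⇒≡ eq u∈ v∈)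

members : Subset n → List (Fin n)
members {n} C = filter (_∈? C) (allFin n)

∈-members⁺ : ∀ {v : Fin n} {C} → v ∈ C → v ∈ˡ members C
∈-members⁺ {C = C} = ∈-filter⁺ (_∈? C) (∈-allFin _)

∈-members⁻ : ∀ {v : Fin n} {C} → v ∈ˡ members C → v ∈ C
∈-members⁻ {n} {C = C} v∈ = proj₂ (∈-filter⁻ (_∈? C) {xs = allFin n} v∈)

members-unique : ∀ (C : Subset n) → Unique (members C)
members-unique {n} C = Unique.filter⁺ (_∈? C) (Unique.allFin⁺ n)

module _ (G : Graph n) where

  Adj-sym : ∀ {u v} → Adj G u v → Adj G v u
  Adj-sym = Sum.swap

  ∈-N⁺ : ∀ {u v} → u ≡ v ⊎ Adj G v u → u ∈ N[ G ] v
  ∈-N⁺ {v = v} = ∈-tabulate⁺ (λ u → (u Fin.≟ v) ⊎-dec adj? G v u)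

  ∈-N⁻ : ∀ {u v} → u ∈ N[ G ] v → u ≡ v ⊎ Adj G v u
  ∈-N⁻ {v = v} = ∈-tabulate⁻ (λ u → (u Fin.≟ v) ⊎-dec adj? G v u)

  ∈-N⟨⟩⁺ : ∀ {W u w} → w ∈ W → u ≡ w ⊎ Adj G w u → u ∈ N[ G ]⟨ W ⟩
  ∈-N⟨⟩⁺ w∈W p = ∈-⋃⁺ (∈-N⁺ p) (∈-map⁺ N[ G ] (∈-members⁺ w∈W))

  ∈-N⟨⟩⁻ : ∀ {W u} → u ∈ N[ G ]⟨ W ⟩ → ∃ λ w → w ∈ W × (u ≡ w ⊎ Adj G w u)
  ∈-N⟨⟩⁻ {W} u∈ with _ , S∈ , u∈S ← ∈-⋃⁻ (map N[ G ] (members W)) u∈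
                with w , w∈ , ≡.refl ← ∈-map⁻ N[ G ] S∈ = w , ∈-members⁻ w∈ , ∈-N⁻ u∈S

module _ (H : Graph n) where

  InEdge : Subset n → Fin n × Fin n → Set
  InEdge C (u , v) = u ∈ C × v ∈ C

  inEdge? : ∀ C e → Dec (InEdge C e)
  inEdge? C (u , v) = (u ∈? C) ×-dec (v ∈? C)

  ∈-edgesWithin⁺ : ∀ {C e} → e ∈ˡ edges H → InEdge C e → e ∈ˡ edgesWithin H C
  ∈-edgesWithin⁺ {C} = ∈-filter⁺ (inEdge? C)

  ∈-edgesWithin⁻ : ∀ {C e} → e ∈ˡ edgesWithin H C → e ∈ˡ edges H × InEdge C e
  ∈-edgesWithin⁻ {C} = ∈-filter⁻ (inEdge? C) {xs = edges H}

  ∈-components⁻ : ∀ {C} → C ∈ˡ components H → IsComponent H C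
  ∈-components⁻ C∈ = proj₂ (∈-filter⁻ (isComponent? H) {xs = subsets n} C∈)

  star-sym : ∀ {u v} → Star (Adj H) u v → Star (Adj H) v u
  star-sym = reverse (Adj-sym H)

  component-closed : ∀ {C u v} → IsComponent H C → u ∈ C → Star (Adj H) u v → v ∈ C
  component-closed (r , C⇔) u∈C u→v = Equivalence.from (C⇔ _) (Equivalence.to (C⇔ _) u∈C ◅◅ u→v)

  component-connected : ∀ {C u v} → IsComponent H C → u ∈ C → v ∈ C → Star (Adj H) u v
  component-connected (r , C⇔) u∈C v∈C =
    star-sym (Equivalence.to (C⇔ _) u∈C) ◅◅ Equivalence.to (C⇔ _) v∈C

  -- Induction along a path: C is closed under adjacency, so the path stays in C and `step` applies
  -- at every edge of it.
  component-propagate : ∀ {C} → IsComponent H C → (P : Fin n → Set) →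
    (∀ {u v} → u ∈ C → v ∈ C → Adj H u v → P u → P v) →
    ∀ {u} → u ∈ C → P u → ∀ {v} → v ∈ C → P v
  component-propagate {C} comp P step u∈C Pu v∈C = go u∈C Pu (component-connected comp u∈C v∈C)
    where
    go : ∀ {u v} → u ∈ C → P u → Star (Adj H) u v → P v
    go u∈C Pu Star.ε      = Pu
    go u∈C Pu (u~w ◅ w→v) = go w∈C (step u∈C w∈C u~w Pu) w→v
      where w∈C = component-closed comp u∈C (u~w ◅ Star.ε)

  component-unique : ∀ {C D v} → IsComponent H C → IsComponent H D → v ∈ C → v ∈ D → C ≡ D
  component-unique compC compD v∈C v∈D = ⊆-antisym
    (λ w∈C → component-closed compD v∈D (component-connected compC v∈C w∈C))
    (λ w∈D → component-closed compC v∈C (component-connected compD v∈D w∈D))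

  components-disjoint : AllPairs (λ C D → ∀ {v} → v ∈ C → v ∉ D) (components H)
  components-disjoint = allPairs-distinct {Q = λ C D → ∀ {v} → v ∈ C → v ∉ D}
    (λ compC compD C≢D {_} v∈C v∈D → C≢D (component-unique compC compD v∈C v∈D))
    (All.tabulate ∈-components⁻)
    (Unique.filter⁺ (isComponent? H) (subsets-unique n))

  component-of : ∀ v → ∃ λ C → C ∈ˡ components H × v ∈ C
  component-of v = C ,
    ∈-filter⁺ (isComponent? H) (∈-subsets C)
      (v , λ w → mk⇔ (∈-tabulate⁻ (star? v)) (∈-tabulate⁺ (star? v))) ,
    ∈-tabulate⁺ (star? v) Star.ε
    where
    open Reachability (adj? H)
    C = Vec.tabulate λ w → does (star? v w)

  vertices-↭ : allFin n ↭ concat (map members (components H))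
  vertices-↭ = partition-↭ (λ C v → v ∈? C) (components H) (Unique.allFin⁺ n) components-disjoint
    λ {v} _ → let C , C∈ , v∈C = component-of v in lose C∈ v∈C

  edges-↭ : edges H ↭ concat (map (edgesWithin H) (components H))
  edges-↭ = partition-↭ inEdge? (components H) (unique H)
    (AllPairs.map (λ disjoint {_} (u∈C , _) (u∈D , _) → disjoint u∈C u∈D) components-disjoint)
    -- The component of one end contains the other end, so every edge lies inside some class.
    λ { {u , v} e∈ → let C , C∈ , u∈C = component-of u in
          lose C∈ (u∈C , component-closed (∈-components⁻ C∈) u∈C (inj₁ e∈ ◅ Star.ε)) }

  -- The ends of an edge are distinct, since edges are stored with the smaller end first. With
  -- `component-edge` this makes the two kinds of components in h(B) complementary.
  singleton⇒no-edges : ∀ {C} → ∣ C ∣ ≡ 1 → ∀ {e} → ¬ e ∈ˡ edgesWithin H C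
  singleton⇒no-edges {C} ∣C∣≡1 e∈ with e∈H , u∈C , v∈C ← ∈-edgesWithin⁻ {C} e∈ =
    Fin.<⇒≢ (All.lookup (ordered H) e∈H) (∣S∣≡1⇒≡ ∣C∣≡1 u∈C v∈C)

  -- If no edge lies inside C, being equal to the root r propagates along paths vacuously, and C is
  -- `⁅ r ⁆`.
  component-edge : ∀ {C} → IsComponent H C → ∣ C ∣ ≢ 1 → ∃ λ e → e ∈ˡ edgesWithin H C
  component-edge {C} comp ∣C∣≢1 with edgesWithin H C in eq
  ... | e ∷ _ = e , here ≡.refl
  ... | []    = contradiction (≡.trans (cong ∣_∣ C≡⁅r⁆) (∣⁅x⁆∣≡1 r)) ∣C∣≢1
    where
    r = proj₁ comp
    r∈C : r ∈ C
    r∈C = Equivalence.from (proj₂ comp r) Star.ε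
    no-adj : ∀ {u v} → u ∈ C → v ∈ C → ¬ Adj H u v
    no-adj u∈C v∈C (inj₁ e∈) with () ← subst (_ ∈ˡ_) eq (∈-edgesWithin⁺ e∈ (u∈C , v∈C))
    no-adj u∈C v∈C (inj₂ e∈) with () ← subst (_ ∈ˡ_) eq (∈-edgesWithin⁺ e∈ (v∈C , u∈C))
    C≡⁅r⁆ : C ≡ ⁅ r ⁆
    C≡⁅r⁆ = ⊆-antisym
      (component-propagate comp (_∈ ⁅ r ⁆)
        (λ u∈C v∈C u~v → contradiction u~v (no-adj u∈C v∈C)) r∈C (x∈⁅x⁆ r))
      (λ v∈ → subst (_∈ C) (≡.sym (x∈⁅y⁆⇒x≡y r v∈)) r∈C)

-- Pairs of vertex sets as labellings

-- A pair of vertex sets (W , U) is encoded as the labelling zip W U.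
Label : Set
Label = Bool × Bool

-- The order is that in which `subsets` splits on W and then on U, so `∑-zip` has only to
-- reassociate.
labels : List Label
labels = (false , false) ∷ (false , true) ∷ (true , false) ∷ (true , true) ∷ []

_≟ᴸ_ : (a b : Label) → Dec (a ≡ b)
_≟ᴸ_ = ×-≡-dec Bool._≟_ Bool._≟_

-- An end labelled `(true , true)` crosses nothing. Hence along a crossed edge the label of one end
-- determines that of the other, as `cross-unique` records.
cross : Label → Label → Bool
cross (true , false) (false , true) = true
cross (false , true) (true , false) = true
cross _              _              = false

Cross : Vec Label n → Fin n × Fin n → Set
Cross f (u , v) = cross (lookup f u) (lookup f v) ≡ true

cross? : ∀ (f : Vec Label n) e → Dec (Cross f e)
cross? f (u , v) = cross (lookup f u) (lookup f v) Bool.≟ true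

cross-sym : ∀ a b → cross a b ≡ true → cross b a ≡ true
cross-sym (true , false) (false , true) _ = ≡.refl
cross-sym (false , true) (true , false) _ = ≡.refl

cross-unique : ∀ a b c → cross a b ≡ true → cross a c ≡ true → b ≡ c
cross-unique (true , false) (false , true) (false , true) _ _ = ≡.refl
cross-unique (false , true) (true , false) (true , false) _ _ = ≡.refl

cross-label : ∀ a b → cross a b ≡ true → a ≡ (true , false) ⊎ a ≡ (false , true)
cross-label (true , false) (false , true) _ = inj₁ ≡.refl
cross-label (false , true) (true , false) _ = inj₂ ≡.refl

cross-∈ : ∀ {W U : Subset n} {u v} → Cross (zip W U) (u , v) → (u ∈ W × v ∈ U) ⊎ (u ∈ U × v ∈ W)
cross-∈ {W = W} {U} {u} {v} eq
  rewrite lookup-zip u W U | lookup-zip v W U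
  with lookup W u in Wu | lookup U u in Uu | lookup W v in Wv | lookup U v in Uv | eq
... | true  | false | false | true  | _ = inj₁ (lookup⇒[]= u W Wu , lookup⇒[]= v U Uv)
... | false | true  | true  | false | _ = inj₂ (lookup⇒[]= u U Uu , lookup⇒[]= v W Wv)

module _ {H : Graph n} where

  bipartition-swap : ∀ {Y Z} → IsBipartition H Y Z → IsBipartition H Z Y
  bipartition-swap {Y} {Z} (isBipartition disjoint covers crossing) = isBipartition
    (≡.trans (∩-comm Z Y) disjoint) (≡.trans (∪-comm Z Y) covers) (All.map Sum.swap crossing)

  bipartition-lookup : ∀ {Y Z} → IsBipartition H Y Z → ∀ v → lookup Y v ≡ not (lookup Z v)
  bipartition-lookup {Y} {Z} (isBipartition disjoint covers _) v
    with lookup Y v in Yv | lookup Z v in Zv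
  ... | true  | false = ≡.refl
  ... | false | true  = ≡.refl
  ... | true  | true  = contradiction
    (subst (v ∈_) disjoint (x∈p∩q⁺ (lookup⇒[]= v Y Yv , lookup⇒[]= v Z Zv))) ∉⊥
  ... | false | false = contradiction (x∈p∪q⁻ Y Z (subst (v ∈_) (≡.sym covers) ∈⊤))
    [ lookup⇒∉ Yv , lookup⇒∉ Zv ]′

  bipartition-cross : ∀ {Y Z} → IsBipartition H Y Z → ∀ {e} → e ∈ˡ edges H → Cross (zip Z Y) e
  bipartition-cross {Y} {Z} bip@(isBipartition _ _ crossing) {u , v} e∈
    rewrite lookup-zip u Z Y | lookup-zip v Z Y
          | bipartition-lookup bip u | bipartition-lookup bip v
    with All.lookup crossing e∈
  ... | inj₁ (u∈Y , v∈Z)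
    rewrite []=⇒lookup v∈Z
          | Bool.not-injective {lookup Z u} {false}
              (≡.trans (≡.sym (bipartition-lookup bip u)) ([]=⇒lookup u∈Y)) = ≡.refl
  ... | inj₂ (u∈Z , v∈Y)
    rewrite []=⇒lookup u∈Z
          | Bool.not-injective {lookup Z v} {false}
              (≡.trans (≡.sym (bipartition-lookup bip v)) ([]=⇒lookup v∈Y)) = ≡.refl

  -- The second side is the complement of W and not U, since vertices in neither set have to be
  -- covered too; on the ends of crossed edges the two choices agree.
  cross⇒bipartite : ∀ (f : Vec Label n) → All (Cross f) (edges H) → Bipartite H
  cross⇒bipartite f crosses =
    W , ∁ W , isBipartition (∩-inverseʳ W) (∪-inverseʳ W) (All.map (λ {e} → side {e}) crosses)
    where
    W = Vec.map proj₁ f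
    side : ∀ {(u , v) : Fin n × Fin n} → Cross f (u , v) →
      (u ∈ W × v ∈ ∁ W) ⊎ (u ∈ ∁ W × v ∈ W)
    side {u , v} c with lookup f u in fu | lookup f v in fv | c
    ... | true , false | false , true | _ = inj₁
      (lookup⇒[]= u W (≡.trans (lookup-map u proj₁ f) (cong proj₁ fu)) ,
       x∉p⇒x∈∁p (lookup⇒∉ (≡.trans (lookup-map v proj₁ f) (cong proj₁ fv))))
    ... | false , true | true , false | _ = inj₂
      (x∉p⇒x∈∁p (lookup⇒∉ (≡.trans (lookup-map u proj₁ f) (cong proj₁ fu))) ,
       lookup⇒[]= v W (≡.trans (lookup-map v proj₁ f) (cong proj₁ fv)))

-- Domination as a signed sum over labellings

module DominationSums (R : CommutativeRing 0ℓ 0ℓ) (x : CommutativeRing.Carrier R) where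
  open CommutativeRing R hiding (zero)
  open RawSemiringDefinitions (Semiring.rawSemiring semiring) using (_^_)
  open RingSums R
  open LabellingSums R labels
  open import Relation.Binary.Reasoning.Setoid setoid

  -- Both sides split on the label of the first vertex. The starting labelling `f` is arbitrary
  -- because every entry of it is overwritten.
  ∑-zip : ∀ n f (φ : Vec Label n → Carrier) →
    ∑ (subsets n) (λ W → ∑ (subsets n) λ U → φ (zip W U)) ≈ ∑ᴸ (allFin n) f φ
  ∑-zip zero    []      φ = trans (+-identityʳ _) (+-identityʳ _)
  ∑-zip (suc n) (c ∷ f) φ = begin
    ∑ (subsets (suc n)) (λ W → ∑ (subsets (suc n)) λ U → φ (zip W U))
      ≈⟨ ∑-subsets n _ ⟩
    ∑ (subsets n) (λ W → ∑ (subsets (suc n)) λ U → φ (zip (outside ∷ W) U)) +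
    ∑ (subsets n) (λ W → ∑ (subsets (suc n)) λ U → φ (zip (inside ∷ W) U))
      ≈⟨ +-cong (half outside) (half inside) ⟩
    (T (false , false) + T (false , true)) + (T (true , false) + T (true , true))
      ≈⟨ +-assoc _ _ _ ⟩
    T (false , false) + (T (false , true) + (T (true , false) + T (true , true)))
      ≈⟨ +-congˡ (+-congˡ (+-congˡ (+-identityʳ _))) ⟨
    ∑ labels T
      ≈⟨ ∑ᴸ-allFin c f φ ⟨
    ∑ᴸ (allFin (suc n)) (c ∷ f) φ ∎
    where
    T : Label → Carrier
    T a = ∑ᴸ (allFin n) f (φ ∘ (a ∷_))
    half : ∀ w → ∑ (subsets n) (λ W → ∑ (subsets (suc n)) λ U → φ (zip (w ∷ W) U)) ≈
                 T (w , false) + T (w , true)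
    half w = begin
      ∑ (subsets n) (λ W → ∑ (subsets (suc n)) λ U → φ (zip (w ∷ W) U))
        ≈⟨ ∑-cong (subsets n) (λ {W} _ → ∑-subsets n (λ U → φ (zip (w ∷ W) U))) ⟩
      ∑ (subsets n) (λ W → ∑ (subsets n) (λ U → φ ((w , false) ∷ zip W U)) +
                           ∑ (subsets n) (λ U → φ ((w , true) ∷ zip W U)))
        ≈⟨ ∑-+ (subsets n) _ _ ⟩
      ∑ (subsets n) (λ W → ∑ (subsets n) λ U → φ ((w , false) ∷ zip W U)) +
      ∑ (subsets n) (λ W → ∑ (subsets n) λ U → φ ((w , true) ∷ zip W U))
        ≈⟨ +-cong (∑-zip n f (φ ∘ ((w , false) ∷_))) (∑-zip n f (φ ∘ ((w , true) ∷_))) ⟩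
      T (w , false) + T (w , true) ∎

  -- The value 0# restricts the sums to disjoint pairs (W , U).
  wt : Label → Carrier
  wt (false , false) = 1#
  wt (false , true)  = - 1#
  wt (true  , false) = x
  wt (true  , true)  = 0#

  -- The edge factor 1 - [e joins U and W] is `1# + κ f e`, the form that `∏-1+-select` expands: a
  -- chosen edge contributes -1 if crossed and kills the term otherwise.
  κ : Vec Label n → Fin n × Fin n → Carrier
  κ f (u , v) = if cross (lookup f u) (lookup f v) then - 1# else 0#

  κ-cross : ∀ {f : Vec Label n} {e} → Cross f e → κ f e ≈ - 1#
  κ-cross c rewrite c = refl

  κ-¬cross : ∀ {f : Vec Label n} {e} → ¬ Cross f e → κ f e ≈ 0#
  κ-¬cross ¬c rewrite Bool.¬-not ¬c = refl

  weight : Graph n → Vec Label n → Carrier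
  weight {n} H f = ∏ (allFin n) (λ v → wt (lookup f v)) * ∏ (edges H) (κ f)

  module _ (G : Graph n) where

    -- Minus the indicator that v is undominated, so that `1# + undominated W v` indicates that v is
    -- dominated.
    undominated : Subset n → Fin n → Carrier
    undominated W v = if does (v ∈? N[ G ]⟨ W ⟩) then 0# else - 1#

    ∏-undominated : ∀ W → ∏ (allFin n) (λ v → 1# + undominated W v) ≈
                          (if does (dominating? G W) then 1# else 0#)
    ∏-undominated W with dominating? G W
    ... | yes N≡⊤ = ∏-one (allFin n) λ {v} _ → dominated v
      where
      dominated : ∀ v → 1# + undominated W v ≈ 1#
      dominated v rewrite dec-true (v ∈? N[ G ]⟨ W ⟩) (subst (v ∈_) (≡.sym N≡⊤) ∈⊤) = +-identityʳ 1#
    ... | no N≢⊤ with v , v∉N ← Fin.¬∀⟶∃¬ n (_∈ N[ G ]⟨ W ⟩) (_∈? N[ G ]⟨ W ⟩)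
                        (λ all∈ → N≢⊤ (⊆-antisym ⊆⊤ λ {v} _ → all∈ v)) =
      ∏-zero (∈-allFin v) vanish
      where
      vanish : 1# + undominated W v ≈ 0#
      vanish rewrite dec-false (v ∈? N[ G ]⟨ W ⟩) v∉N = -‿inverseʳ 1#

    module _ (W U : Subset n) where
      private
        f = zip W U
        N = N[ G ]⟨ W ⟩
        factor : Fin n → Carrier
        factor v = (if lookup W v then x else 1#) * (if lookup U v then undominated W v else 1#)

      wt-∈∈ : ∀ {v} → v ∈ W → v ∈ U → wt (lookup f v) ≈ 0#
      wt-∈∈ {v} v∈W v∈U rewrite lookup-zip v W U | []=⇒lookup v∈W | []=⇒lookup v∈U = refl

      cross-edge : ∀ {w v} → w ∈ W → v ∈ U → w ∉ U → v ∉ W → Cross f (w , v)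
      cross-edge {w} {v} w∈W v∈U w∉U v∉W
        rewrite lookup-zip v W U | lookup-zip w W U
              | []=⇒lookup w∈W | []=⇒lookup v∈U | ∉⇒lookup w∉U | ∉⇒lookup v∉W = ≡.refl

      -- N[W] contains W and all its neighbours, so U is disjoint from W and no edge joins them: all
      -- edge factors are 1 and the vertex factors agree one by one.
      undominated-≈ : (∀ v → v ∈ U → v ∉ N) →
        ∏ (allFin n) factor ≈ ∏ (allFin n) (λ v → wt (lookup f v)) * ∏ (edges G) (λ e → 1# + κ f e)
      undominated-≈ U∉N = begin
        ∏ (allFin n) factor
          ≈⟨ ∏-cong (allFin n) (λ {v} _ → factor≈wt v) ⟩
        ∏ (allFin n) (λ v → wt (lookup f v))
          ≈⟨ *-identityʳ _ ⟨
        ∏ (allFin n) (λ v → wt (lookup f v)) * 1#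
          ≈⟨ *-congˡ (∏-one (edges G) (λ {e} e∈ → trans
               (+-congˡ (κ-¬cross {f = f} {e} (no-cross e∈))) (+-identityʳ 1#))) ⟨
        ∏ (allFin n) (λ v → wt (lookup f v)) * ∏ (edges G) (λ e → 1# + κ f e) ∎
        where
        factor≈wt : ∀ v → factor v ≈ wt (lookup f v)
        factor≈wt v rewrite lookup-zip v W U with lookup W v in Wv | lookup U v in Uv
        ... | false | false = *-identityˡ _
        ... | true  | false = *-identityʳ _
        ... | true  | true  = contradiction
          (∈-N⟨⟩⁺ G (lookup⇒[]= v W Wv) (inj₁ ≡.refl)) (U∉N v (lookup⇒[]= v U Uv))
        ... | false | true
          rewrite dec-false (v ∈? N) (U∉N v (lookup⇒[]= v U Uv)) = *-identityˡ _
        no-cross : ∀ {e} → e ∈ˡ edges G → ¬ Cross f e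
        no-cross e∈ c with cross-∈ {W = W} {U} c
        ... | inj₁ (u∈W , v∈U) = U∉N _ v∈U (∈-N⟨⟩⁺ G u∈W (inj₂ (inj₁ e∈)))
        ... | inj₂ (u∈U , v∈W) = U∉N _ u∈U (∈-N⟨⟩⁺ G v∈W (inj₂ (inj₂ e∈)))

      -- Both sides vanish. On the left the factor at v is 0. On the right, either v or the
      -- neighbour w that dominates it lies in both sets and has weight 0, or the edge between them
      -- is crossed and its factor is 1 - 1.
      dominated-≈ : ∀ {v} → v ∈ U → v ∈ N →
        ∏ (allFin n) factor ≈ ∏ (allFin n) (λ v → wt (lookup f v)) * ∏ (edges G) (λ e → 1# + κ f e)
      dominated-≈ {v} v∈U v∈N = trans (∏-zero (∈-allFin v) factor≈0) (sym rhs≈0)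
        where
        factor≈0 : factor v ≈ 0#
        factor≈0 rewrite []=⇒lookup v∈U | dec-true (v ∈? N) v∈N = zeroʳ _

        vertex-zero : ∀ {u} → u ∈ W → u ∈ U →
          ∏ (allFin n) (λ v → wt (lookup f v)) * ∏ (edges G) (λ e → 1# + κ f e) ≈ 0#
        vertex-zero {u} u∈W u∈U = trans (*-congʳ (∏-zero {f = wt ∘ lookup f} (∈-allFin u)
          (wt-∈∈ u∈W u∈U))) (zeroˡ _)

        edge-zero : ∀ {e} → e ∈ˡ edges G → Cross f e →
          ∏ (allFin n) (λ v → wt (lookup f v)) * ∏ (edges G) (λ e → 1# + κ f e) ≈ 0#
        edge-zero {e} e∈ c = trans (*-congˡ (∏-zero e∈
          (trans (+-congˡ (κ-cross {f = f} {e} c)) (-‿inverseʳ 1#)))) (zeroʳ _)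

        rhs≈0 : ∏ (allFin n) (λ v → wt (lookup f v)) * ∏ (edges G) (λ e → 1# + κ f e) ≈ 0#
        rhs≈0 with ∈-N⟨⟩⁻ G v∈N
        ... | w , w∈W , inj₁ ≡.refl = vertex-zero w∈W v∈U
        ... | w , w∈W , inj₂ w~v with w ∈? U | v ∈? W
        ...   | yes w∈U | _      = vertex-zero w∈W w∈U
        ...   | no _    | yes v∈W = vertex-zero v∈W v∈U
        ...   | no w∉U  | no v∉W with w~v
        ...     | inj₁ e∈ = edge-zero e∈ (cross-edge w∈W v∈U w∉U v∉W)
        ...     | inj₂ e∈ = edge-zero e∈ (cross-sym (lookup f w) (lookup f v)
          (cross-edge w∈W v∈U w∉U v∉W))

      ∏-factor : ∏ (allFin n) factor ≈
        ∏ (allFin n) (λ v → wt (lookup f v)) * ∏ (edges G) (λ e → 1# + κ f e)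
      ∏-factor with Fin.any? (λ v → (v ∈? U) ×-dec (v ∈? N))
      ... | yes (v , v∈U , v∈N) = dominated-≈ v∈U v∈N
      ... | no none = undominated-≈ λ v v∈U v∈N → none (v , v∈U , v∈N)

      domination-term :
        x ^ ∣ W ∣ * ∏ (allFin n) (λ v → if lookup U v then undominated W v else 1#) ≈
        ∑ (subsets (length (edges G))) λ B → weight (spanning G B) f
      domination-term = begin
        x ^ ∣ W ∣ * ∏ (allFin n) (λ v → if lookup U v then undominated W v else 1#)
          ≈⟨ *-congʳ (∏-subset x W) ⟨
        ∏ (allFin n) (λ v → if lookup W v then x else 1#) *
        ∏ (allFin n) (λ v → if lookup U v then undominated W v else 1#)
          ≈⟨ ∏-* (allFin n) _ _ ⟨
        ∏ (allFin n) factor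
          ≈⟨ ∏-factor ⟩
        ∏ (allFin n) (λ v → wt (lookup f v)) * ∏ (edges G) (λ e → 1# + κ f e)
          ≈⟨ *-congˡ (∏-1+-select (edges G) (κ f)) ⟩
        ∏ (allFin n) (λ v → wt (lookup f v)) *
        ∑ (subsets (length (edges G))) (λ B → ∏ (select (edges G) B) (κ f))
          ≈⟨ ∑-*ˡ _ (subsets (length (edges G))) _ ⟩
        ∑ (subsets (length (edges G))) (λ B → weight (spanning G B) f) ∎

    dominating-sum : ∀ f₀ →
      ∑ (subsets n) (λ W → if does (dominating? G W) then x ^ ∣ W ∣ else 0#) ≈
      ∑ (subsets (length (edges G))) λ B → ∑ᴸ (allFin n) f₀ (weight (spanning G B))
    dominating-sum f₀ = begin
      ∑ (subsets n) (λ W → if does (dominating? G W) then x ^ ∣ W ∣ else 0#)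
        ≈⟨ ∑-cong (subsets n) (λ {W} _ → trans (indicator (does (dominating? G W)) (x ^ ∣ W ∣))
             (*-congˡ (sym (∏-undominated W)))) ⟩
      ∑ (subsets n) (λ W → x ^ ∣ W ∣ * ∏ (allFin n) (λ v → 1# + undominated W v))
        ≈⟨ ∑-cong (subsets n) (λ {W} _ → trans (*-congˡ (∏-1+-lookup (undominated W)))
             (∑-*ˡ _ (subsets n) _)) ⟩
      ∑ (subsets n) (λ W → ∑ (subsets n) λ U →
        x ^ ∣ W ∣ * ∏ (allFin n) (λ v → if lookup U v then undominated W v else 1#))
        ≈⟨ ∑-cong (subsets n) (λ {W} _ → ∑-cong (subsets n) λ {U} _ → domination-term W U) ⟩
      ∑ (subsets n) (λ W → ∑ (subsets n) λ U → ∑ Bs λ B → weight (spanning G B) (zip W U))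
        ≈⟨ ∑-cong (subsets n) (λ {W} _ →
             ∑-swap (subsets n) Bs λ U B → weight (spanning G B) (zip W U)) ⟩
      ∑ (subsets n) (λ W → ∑ Bs λ B → ∑ (subsets n) λ U → weight (spanning G B) (zip W U))
        ≈⟨ ∑-swap (subsets n) Bs (λ W B → ∑ (subsets n) λ U → weight (spanning G B) (zip W U)) ⟩
      ∑ Bs (λ B → ∑ (subsets n) λ W → ∑ (subsets n) λ U → weight (spanning G B) (zip W U))
        ≈⟨ ∑-cong Bs (λ {B} _ → ∑-zip n f₀ (weight (spanning G B))) ⟩
      ∑ Bs (λ B → ∑ᴸ (allFin n) f₀ (weight (spanning G B))) ∎
      where
      Bs = subsets (length (edges G))
      indicator : ∀ b c → (if b then c else 0#) ≈ c * (if b then 1# else 0#)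
      indicator true  c = sym (*-identityʳ c)
      indicator false c = sym (zeroʳ c)

-- Evaluation of the sum over labellings, component by component

module ComponentSums (R : CommutativeRing 0ℓ 0ℓ) (x : CommutativeRing.Carrier R) where
  open CommutativeRing R hiding (zero)
  open RawSemiringDefinitions (Semiring.rawSemiring semiring) using (_^_)
  open RingSums R
  open LabellingSums R labels
  open DominationSums R x
  open import Relation.Binary.Reasoning.Setoid setoid

  ∏-members : ∀ a (T C : Subset n) →
    ∏ (members C) (λ v → if lookup T v then a else 1#) ≈ a ^ ∣ T ∩ C ∣
  ∏-members {n} a T C = begin
    ∏ (members C) (λ v → if lookup T v then a else 1#)
      ≈⟨ ∏-filter (_∈? C) (allFin n) _ ⟩
    ∏ (allFin n) (λ v → if does (v ∈? C) then (if lookup T v then a else 1#) else 1#)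
      ≈⟨ ∏-cong (allFin n) (λ {v} _ → reflexive (pointwise v)) ⟩
    ∏ (allFin n) (λ v → if lookup (T ∩ C) v then a else 1#)
      ≈⟨ ∏-subset a (T ∩ C) ⟩
    a ^ ∣ T ∩ C ∣ ∎
    where
    pointwise : ∀ v → (if does (v ∈? C) then (if lookup T v then a else 1#) else 1#) ≡
                      (if lookup (T ∩ C) v then a else 1#)
    pointwise v rewrite does-∈? v C | lookup-zipWith _∧_ v T C with lookup T v | lookup C v
    ... | true  | true  = ≡.refl
    ... | true  | false = ≡.refl
    ... | false | true  = ≡.refl
    ... | false | false = ≡.refl

  -- P and Q are complementary on `is`. The intended instance sorts the components into single
  -- vertices, each contributing x, and those with an edge.
  ∏-split : ∀ {P Q : I → Set} (P? : Decidable P) (Q? : Decidable Q) c (s t : I → Carrier) is →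
    (∀ {i} → i ∈ˡ is → (P i × ¬ Q i × t i ≈ c) ⊎ (¬ P i × Q i × t i ≈ s i)) →
    ∏ is t ≈ c ^ length (filter P? is) * ∏ (filter Q? is) s
  ∏-split P? Q? c s t []       cases = sym (*-identityʳ 1#)
  ∏-split P? Q? c s t (i ∷ is) cases
    with P? i | Q? i | cases (here ≡.refl) | ∏-split P? Q? c s t is (cases ∘ there)
  ... | yes _ | no _  | inj₁ (_ , _ , ti≈c) | rest = trans (*-cong ti≈c rest) (sym (*-assoc _ _ _))
  ... | no _  | yes _ | inj₂ (_ , _ , ti≈s) | rest = trans (*-cong ti≈s rest) (x∙yz≈y∙xz _ _ _)
    where open CommutativeSemigroupProperties *-commutativeSemigroup using (x∙yz≈y∙xz)
  ... | yes p | _     | inj₂ (¬p , _ , _)   | _ = contradiction p ¬p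
  ... | _     | yes q | inj₁ (_ , ¬q , _)   | _ = contradiction q ¬q
  ... | no ¬p | _     | inj₁ (p , _ , _)    | _ = contradiction p ¬p
  ... | _     | no ¬q | inj₂ (_ , q , _)    | _ = contradiction q ¬q

  -- Kronecker delta of the restrictions of f and g to C, written as a product over vertices so that
  -- `∑ᴸ-∏` can sum it.
  δ : Subset n → Vec Label n → Vec Label n → Carrier
  δ C g f = ∏ (members C) λ v → if does (lookup f v ≟ᴸ lookup g v) then 1# else 0#

  δ-agree : ∀ {C} {f g : Vec Label n} → (∀ {v} → v ∈ C → lookup f v ≡ lookup g v) → δ C g f ≈ 1#
  δ-agree {C = C} {f} {g} agree = ∏-one (members C) λ {v} v∈ → reflexive
    (cong (if_then 1# else 0#) (dec-true (lookup f v ≟ᴸ lookup g v) (agree (∈-members⁻ v∈))))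

  δ-differ : ∀ {C v} {f g : Vec Label n} → v ∈ C → lookup f v ≢ lookup g v → δ C g f ≈ 0#
  δ-differ {C = C} {v} {f} {g} v∈C f≢g = ∏-zero {xs = members C} (∈-members⁺ v∈C) (reflexive
    (cong (if_then 1# else 0#) (dec-false (lookup f v ≟ᴸ lookup g v) f≢g)))

  -- At each vertex exactly one of the four labels matches that of g.
  ∑ᴸ-δ : ∀ C (g f₀ : Vec Label n) → ∑ᴸ (members C) f₀ (δ C g) ≈ 1#
  ∑ᴸ-δ C g f₀ = trans
    (∑ᴸ-∏ (λ v a → if does (a ≟ᴸ lookup g v) then 1# else 0#) f₀ (members-unique C))
    (∏-one (members C) λ {v} _ → total (lookup g v))
    where
    total : ∀ b → ∑ labels (λ a → if does (a ≟ᴸ b) then 1# else 0#) ≈ 1#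
    total (false , false) =
      trans (+-congˡ (trans (+-identityˡ _) (trans (+-identityˡ _) (+-identityˡ _)))) (+-identityʳ 1#)
    total (false , true)  = trans (+-identityˡ _)
      (trans (+-congˡ (trans (+-identityˡ _) (+-identityˡ _))) (+-identityʳ 1#))
    total (true , false)  = trans (+-identityˡ _) (trans (+-identityˡ _)
      (trans (+-congˡ (+-identityˡ _)) (+-identityʳ 1#)))
    total (true , true)   = trans (+-identityˡ _) (trans (+-identityˡ _)
      (trans (+-identityˡ _) (+-identityʳ 1#)))

  ∑-wt : ∑ labels wt ≈ x
  ∑-wt = begin
    1# + (- 1# + (x + (0# + 0#))) ≈⟨ +-assoc _ _ _ ⟨
    (1# + - 1#) + (x + (0# + 0#)) ≈⟨ +-cong (-‿inverseʳ 1#) (+-congˡ (+-identityʳ 0#)) ⟩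
    0# + (x + 0#)                 ≈⟨ +-identityˡ _ ⟩
    x + 0#                        ≈⟨ +-identityʳ x ⟩
    x                             ∎

  bracket : (ℕ → Carrier) → (H : Graph n) (Y Z C : Subset n) → Carrier
  bracket sgn H Y Z C =
    sgn (length (edgesWithin H C)) *
    (sgn ∣ Y ∩ C ∣ * x ^ ∣ Z ∩ C ∣ + sgn ∣ Z ∩ C ∣ * x ^ ∣ Y ∩ C ∣)

  -- sgn is a parameter so that the instance at ℤ[x] with sgn = sign is definitionally h.
  summand : (ℕ → Carrier) → (H : Graph n) (Y Z : Subset n) → Carrier
  summand sgn H Y Z =
    x ^ length (isolatedComponents H) * ∏ (nontrivialComponents H) (bracket sgn H Y Z)

  summand-cong : ∀ {sgn sgn′} → (∀ m → sgn m ≈ sgn′ m) → ∀ (H : Graph n) Y Z →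
    summand sgn H Y Z ≈ summand sgn′ H Y Z
  summand-cong eq H Y Z = *-congˡ (∏-cong (nontrivialComponents H) λ _ →
    *-cong (eq _) (+-cong (*-congʳ (eq _)) (*-congʳ (eq _))))

  module _ (H : Graph n) where

    block : Subset n → Vec Label n → Carrier
    block C f = ∏ (members C) (wt ∘ lookup f) * ∏ (edgesWithin H C) (κ f)

    block-dependsOn : ∀ C → DependsOn (members C) (block C)
    block-dependsOn C f g agree = *-cong
      (∏-cong (members C) λ v∈ → reflexive (cong wt (agree v∈)))
      (∏-cong (edgesWithin H C) λ e∈ → let _ , u∈C , v∈C = ∈-edgesWithin⁻ H {C} e∈ in
        reflexive (cong (if_then - 1# else 0#)
          (cong₂ cross (agree (∈-members⁺ u∈C)) (agree (∈-members⁺ v∈C)))))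

    weight-blocks : ∀ f → weight H f ≈ ∏ (components H) λ C → block C f
    weight-blocks f = begin
      ∏ (allFin n) (wt ∘ lookup f) * ∏ (edges H) (κ f)
        ≈⟨ *-cong (∏-↭ _ (vertices-↭ H)) (∏-↭ _ (edges-↭ H)) ⟩
      ∏ (concat (map members Cs)) (wt ∘ lookup f) * ∏ (concat (map (edgesWithin H) Cs)) (κ f)
        ≈⟨ *-cong (∏-concat members Cs _) (∏-concat (edgesWithin H) Cs _) ⟩
      ∏ Cs (λ C → ∏ (members C) (wt ∘ lookup f)) * ∏ Cs (λ C → ∏ (edgesWithin H C) (κ f))
        ≈⟨ ∏-* Cs _ _ ⟨
      ∏ Cs (λ C → block C f) ∎
      where Cs = components H

    ∑ᴸ-weight : ∀ f₀ → ∑ᴸ (allFin n) f₀ (weight H) ≈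
      ∏ (components H) λ C → ∑ᴸ (members C) f₀ (block C)
    ∑ᴸ-weight f₀ = begin
      ∑ᴸ (allFin n) f₀ (weight H)
        ≈⟨ ∑ᴸ-↭ f₀ (weight H) (vertices-↭ H) ⟩
      ∑ᴸ (concat (map members (components H))) f₀ (weight H)
        ≈⟨ ∑ᴸ-cong (concat (map members (components H))) f₀ weight-blocks ⟩
      ∑ᴸ (concat (map members (components H))) f₀ (λ f → ∏ (components H) λ C → block C f)
        ≈⟨ ∑ᴸ-blocks members block block-dependsOn f₀
             (AllPairs.map (λ disjoint {_} v∈C v∈D → disjoint (∈-members⁻ v∈C) (∈-members⁻ v∈D))
               (components-disjoint H)) ⟩
      ∏ (components H) (λ C → ∑ᴸ (members C) f₀ (block C)) ∎

    -- A labelling crossed by all edges would yield a bipartition, so each labelling leaves an edge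
    -- uncrossed, and that edge has `κ` equal to 0.
    ∑ᴸ-weight-¬bipartite : ¬ Bipartite H → ∀ f₀ → ∑ᴸ (allFin n) f₀ (weight H) ≈ 0#
    ∑ᴸ-weight-¬bipartite ¬bip f₀ = trans (∑ᴸ-cong (allFin n) f₀ vanish) (∑ᴸ-zero (allFin n) f₀)
      where
      vanish : ∀ f → weight H f ≈ 0#
      vanish f with e , e∈ , ¬c ←
          find (All.¬All⇒Any¬ (cross? f) (edges H) (¬bip ∘ cross⇒bipartite f)) =
        trans (*-congˡ (∏-zero e∈ (κ-¬cross {f = f} {e} ¬c))) (zeroʳ _)

    ∑ᴸ-block-singleton : ∀ {C} → ∣ C ∣ ≡ 1 → ∀ f₀ → ∑ᴸ (members C) f₀ (block C) ≈ x
    ∑ᴸ-block-singleton {C} ∣C∣≡1 f₀ = begin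
      ∑ᴸ (members C) f₀ (block C)
        ≈⟨ ∑ᴸ-cong (members C) f₀ (λ f → trans
             (*-congˡ (∏-one (edgesWithin H C) λ e∈ →
               contradiction e∈ (singleton⇒no-edges H ∣C∣≡1)))
             (*-identityʳ _)) ⟩
      ∑ᴸ (members C) f₀ (λ f → ∏ (members C) (wt ∘ lookup f))
        ≈⟨ ∑ᴸ-∏ (λ _ → wt) f₀ (members-unique C) ⟩
      ∏ (members C) (λ _ → ∑ labels wt)
        -- Writing the constant x as an indicator of C lets `∏-members` count the vertices of C.
        ≈⟨ ∏-cong (members C) (λ {v} v∈ → trans ∑-wt (reflexive (cong (if_then x else 1#)
             (≡.sym ([]=⇒lookup (∈-members⁻ v∈)))))) ⟩
      ∏ (members C) (λ v → if lookup C v then x else 1#)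
        ≈⟨ ∏-members x C C ⟩
      x ^ ∣ C ∩ C ∣
        ≡⟨ cong (x ^_) (≡.trans (cong ∣_∣ (∩-idem C)) ∣C∣≡1) ⟩
      x * 1#
        ≈⟨ *-identityʳ x ⟩
      x ∎

    -- zip Z Y stands for W = Z and U = Y, whence the exchange of the two sets.
    block-bipartition : ∀ {Y Z} → IsBipartition H Y Z → ∀ C → block C (zip Z Y) ≈
      (- 1#) ^ length (edgesWithin H C) * ((- 1#) ^ ∣ Y ∩ C ∣ * x ^ ∣ Z ∩ C ∣)
    block-bipartition {Y} {Z} bip C = begin
      ∏ (members C) (wt ∘ lookup (zip Z Y)) * ∏ (edgesWithin H C) (κ (zip Z Y))
        ≈⟨ *-cong (∏-cong (members C) λ {v} _ → vertex v)
                  (∏-cong (edgesWithin H C) λ {e} e∈ → κ-cross {f = zip Z Y} {e}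
                    (bipartition-cross bip (proj₁ (∈-edgesWithin⁻ H {C} e∈)))) ⟩
      ∏ (members C) (λ v → (if lookup Y v then - 1# else 1#) * (if lookup Z v then x else 1#)) *
      ∏ (edgesWithin H C) (λ _ → - 1#)
        ≈⟨ *-cong (∏-* (members C) _ _) (reflexive (∏-const (- 1#) (edgesWithin H C))) ⟩
      ∏ (members C) (λ v → if lookup Y v then - 1# else 1#) *
      ∏ (members C) (λ v → if lookup Z v then x else 1#) *
      (- 1#) ^ length (edgesWithin H C)
        ≈⟨ *-congʳ (*-cong (∏-members (- 1#) Y C) (∏-members x Z C)) ⟩
      (- 1#) ^ ∣ Y ∩ C ∣ * x ^ ∣ Z ∩ C ∣ * (- 1#) ^ length (edgesWithin H C)
        ≈⟨ *-comm _ _ ⟩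
      (- 1#) ^ length (edgesWithin H C) * ((- 1#) ^ ∣ Y ∩ C ∣ * x ^ ∣ Z ∩ C ∣) ∎
      where
      vertex : ∀ v → wt (lookup (zip Z Y) v) ≈
        (if lookup Y v then - 1# else 1#) * (if lookup Z v then x else 1#)
      vertex v rewrite lookup-zip v Z Y | bipartition-lookup bip v with lookup Z v
      ... | true  = sym (*-identityˡ x)
      ... | false = sym (*-identityʳ (- 1#))

    -- By `cross-unique` a crossed edge carries agreement from one end to the other. `cross-sym`
    -- handles edges traversed against their stored orientation.
    cross-propagate : ∀ {C} → IsComponent H C → ∀ {f g : Vec Label n} →
      (∀ {e} → e ∈ˡ edgesWithin H C → Cross f e) → (∀ {e} → e ∈ˡ edgesWithin H C → Cross g e) →
      ∀ {u} → u ∈ C → lookup f u ≡ lookup g u → ∀ {v} → v ∈ C → lookup f v ≡ lookup g v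
    cross-propagate {C} comp {f} {g} f-cross g-cross =
      component-propagate H comp (λ v → lookup f v ≡ lookup g v) step
      where
      step : ∀ {u v} → u ∈ C → v ∈ C → Adj H u v →
        lookup f u ≡ lookup g u → lookup f v ≡ lookup g v
      step {u} {v} u∈C v∈C (inj₁ e∈) eq = cross-unique (lookup g u) _ _
        (subst (λ a → cross a (lookup f v) ≡ true) eq (f-cross e∈C)) (g-cross e∈C)
        where e∈C = ∈-edgesWithin⁺ H e∈ (u∈C , v∈C)
      step {u} {v} u∈C v∈C (inj₂ e∈) eq = cross-unique (lookup g u) _ _
        (subst (λ a → cross a (lookup f v) ≡ true) eq
          (cross-sym (lookup f v) (lookup f u) (f-cross e∈C)))
        (cross-sym (lookup g v) (lookup g u) (g-cross e∈C))
        where e∈C = ∈-edgesWithin⁺ H e∈ (v∈C , u∈C)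

    module _ {Y Z} (bip : IsBipartition H Y Z) {C} (comp : IsComponent H C) where

      private
        g₁ = zip Z Y
        g₂ = zip Y Z
        g₁-cross : ∀ {e} → e ∈ˡ edgesWithin H C → Cross g₁ e
        g₁-cross e∈ = bipartition-cross bip (proj₁ (∈-edgesWithin⁻ H {C} e∈))
        g₂-cross : ∀ {e} → e ∈ˡ edgesWithin H C → Cross g₂ e
        g₂-cross e∈ = bipartition-cross (bipartition-swap bip) (proj₁ (∈-edgesWithin⁻ H {C} e∈))

      -- Exactly one of Y and Z contains v, so the two labels at v are `(true , false)` and
      -- `(false , true)` in some order.
      g₁≢g₂ : ∀ v → lookup g₁ v ≢ lookup g₂ v
      g₁≢g₂ v rewrite lookup-zip v Z Y | lookup-zip v Y Z | bipartition-lookup bip v with lookup Z v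
      ... | true  = λ ()
      ... | false = λ ()

      g₁-or-g₂ : ∀ v a → a ≡ (true , false) ⊎ a ≡ (false , true) → a ≡ lookup g₁ v ⊎ a ≡ lookup g₂ v
      g₁-or-g₂ v a p rewrite lookup-zip v Z Y | lookup-zip v Y Z | bipartition-lookup bip v
        with lookup Z v | p
      ... | true  | inj₁ eq = inj₁ eq
      ... | true  | inj₂ eq = inj₂ eq
      ... | false | inj₁ eq = inj₂ eq
      ... | false | inj₂ eq = inj₁ eq

      -- A labelling crossed by all edges of C is determined by its label at one vertex, which is
      -- that of g₁ or that of g₂; for any other labelling both sides vanish.
      block-δ : ∀ {e} → e ∈ˡ edgesWithin H C → ∀ f →
        block C f ≈ block C g₁ * δ C g₁ f + block C g₂ * δ C g₂ f
      block-δ {u , w} e∈ f with All.all? (cross? f) (edgesWithin H C)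
      ... | no ¬crosses = begin
        block C f
          ≈⟨ trans (*-congˡ (∏-zero e′∈ (κ-¬cross {f = f} {e′} ¬c))) (zeroʳ _) ⟩
        0#
          ≈⟨ +-identityʳ 0# ⟨
        0# + 0#
          ≈⟨ +-cong (trans (*-congˡ (δ≈0 {g₁} g₁-cross)) (zeroʳ _))
                    (trans (*-congˡ (δ≈0 {g₂} g₂-cross)) (zeroʳ _)) ⟨
        block C g₁ * δ C g₁ f + block C g₂ * δ C g₂ f ∎
        where
        witness = find (All.¬All⇒Any¬ (cross? f) (edgesWithin H C) ¬crosses)
        e′ = proj₁ witness
        e′∈ = proj₁ (proj₂ witness)
        ¬c = proj₂ (proj₂ witness)
        a = proj₁ e′
        b = proj₂ e′
        a∈C = proj₁ (proj₂ (∈-edgesWithin⁻ H {C} e′∈))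
        b∈C = proj₂ (proj₂ (∈-edgesWithin⁻ H {C} e′∈))
        -- A labelling f that agreed with g at both ends of `e′` would cross `e′`, as g does.
        δ≈0 : ∀ {g} → (∀ {e} → e ∈ˡ edgesWithin H C → Cross g e) → δ C g f ≈ 0#
        δ≈0 {g} g-cross with lookup f a ≟ᴸ lookup g a | lookup f b ≟ᴸ lookup g b
        ... | no fa≢ga | _ = δ-differ {C = C} {a} {f} {g} a∈C fa≢ga
        ... | yes _ | no fb≢gb = δ-differ {C = C} {b} {f} {g} b∈C fb≢gb
        ... | yes fa≡ga | yes fb≡gb =
          contradiction (≡.trans (cong₂ cross fa≡ga fb≡gb) (g-cross e′∈)) ¬c
      -- The given edge is crossed, so its end u lies in exactly one of W and U; this label selects
      -- the ordering with which f agrees.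
      ... | yes crosses
        with g₁-or-g₂ u (lookup f u) (cross-label _ (lookup f w) (All.lookup crosses e∈))
      ...   | inj₁ fu≡g₁u = begin
        block C f
          ≈⟨ block-dependsOn C f g₁ (agree ∘ ∈-members⁻) ⟩
        block C g₁
          ≈⟨ trans (+-cong (*-identityʳ _) (zeroʳ _)) (+-identityʳ _) ⟨
        block C g₁ * 1# + block C g₂ * 0#
          ≈⟨ +-cong (*-congˡ (δ-agree {C = C} {f} {g₁} agree))
                    (*-congˡ (δ-differ {C = C} {u} {f} {g₂} u∈C λ fu≡g₂u →
                      g₁≢g₂ u (≡.trans (≡.sym fu≡g₁u) fu≡g₂u))) ⟨
        block C g₁ * δ C g₁ f + block C g₂ * δ C g₂ f ∎
        where
        u∈C = proj₁ (proj₂ (∈-edgesWithin⁻ H {C} e∈))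
        agree : ∀ {v} → v ∈ C → lookup f v ≡ lookup g₁ v
        agree = cross-propagate comp {f} {g₁} (All.lookup crosses) g₁-cross u∈C fu≡g₁u
      ...   | inj₂ fu≡g₂u = begin
        block C f
          ≈⟨ block-dependsOn C f g₂ (agree ∘ ∈-members⁻) ⟩
        block C g₂
          ≈⟨ trans (+-cong (zeroʳ _) (*-identityʳ _)) (+-identityˡ _) ⟨
        block C g₁ * 0# + block C g₂ * 1#
          ≈⟨ +-cong (*-congˡ (δ-differ {C = C} {u} {f} {g₁} u∈C λ fu≡g₁u →
                      g₁≢g₂ u (≡.trans (≡.sym fu≡g₁u) fu≡g₂u)))
                    (*-congˡ (δ-agree {C = C} {f} {g₂} agree)) ⟨
        block C g₁ * δ C g₁ f + block C g₂ * δ C g₂ f ∎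
        where
        u∈C = proj₁ (proj₂ (∈-edgesWithin⁻ H {C} e∈))
        agree : ∀ {v} → v ∈ C → lookup f v ≡ lookup g₂ v
        agree = cross-propagate comp {f} {g₂} (All.lookup crosses) g₂-cross u∈C fu≡g₂u

      -- Each delta sums to 1, which leaves the values of `block C` at the two orderings; their
      -- common sign, from the edges, factors out.
      ∑ᴸ-block : ∀ {e} → e ∈ˡ edgesWithin H C → ∀ f₀ → ∑ᴸ (members C) f₀ (block C) ≈
        bracket ((- 1#) ^_) H Y Z C
      ∑ᴸ-block e∈ f₀ = begin
        ∑ᴸ (members C) f₀ (block C)
          ≈⟨ ∑ᴸ-cong (members C) f₀ (block-δ e∈) ⟩
        ∑ᴸ (members C) f₀ (λ f → block C g₁ * δ C g₁ f + block C g₂ * δ C g₂ f)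
          ≈⟨ ∑ᴸ-+ (members C) f₀ (λ f → block C g₁ * δ C g₁ f) (λ f → block C g₂ * δ C g₂ f) ⟩
        ∑ᴸ (members C) f₀ (λ f → block C g₁ * δ C g₁ f) +
        ∑ᴸ (members C) f₀ (λ f → block C g₂ * δ C g₂ f)
          ≈⟨ +-cong (pull g₁) (pull g₂) ⟩
        block C g₁ + block C g₂
          ≈⟨ +-cong (block-bipartition bip C) (block-bipartition (bipartition-swap bip) C) ⟩
        (- 1#) ^ m * ((- 1#) ^ ∣ Y ∩ C ∣ * x ^ ∣ Z ∩ C ∣) +
        (- 1#) ^ m * ((- 1#) ^ ∣ Z ∩ C ∣ * x ^ ∣ Y ∩ C ∣)
          ≈⟨ distribˡ _ _ _ ⟨
        (- 1#) ^ m *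
        ((- 1#) ^ ∣ Y ∩ C ∣ * x ^ ∣ Z ∩ C ∣ + (- 1#) ^ ∣ Z ∩ C ∣ * x ^ ∣ Y ∩ C ∣) ∎
        where
        m = length (edgesWithin H C)
        pull : ∀ g → ∑ᴸ (members C) f₀ (λ f → block C g * δ C g f) ≈ block C g
        pull g = trans
          (∑ᴸ-*ˡ (members C) f₀ {φ = λ _ → block C g} {ψ = δ C g} (λ _ _ _ → refl))
          (trans (*-congˡ (∑ᴸ-δ C g f₀)) (*-identityʳ _))

    ∑ᴸ-weight-bipartite : ∀ {Y Z} → IsBipartition H Y Z → ∀ f₀ →
      ∑ᴸ (allFin n) f₀ (weight H) ≈ summand ((- 1#) ^_) H Y Z
    ∑ᴸ-weight-bipartite {Y} {Z} bip f₀ = trans (∑ᴸ-weight f₀) (∏-split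
      (λ C → ∣ C ∣ ℕ.≟ 1) (λ C → 1 ℕ.≤? length (edgesWithin H C)) x _ _ (components H) cases)
      where
      cases : ∀ {C} → C ∈ˡ components H →
        (∣ C ∣ ≡ 1 × ¬ 1 ℕ.≤ length (edgesWithin H C) × ∑ᴸ (members C) f₀ (block C) ≈ x) ⊎
        (∣ C ∣ ≢ 1 × 1 ℕ.≤ length (edgesWithin H C) × ∑ᴸ (members C) f₀ (block C) ≈
          bracket ((- 1#) ^_) H Y Z C)
      cases {C} C∈ with ∣ C ∣ ℕ.≟ 1
      ... | yes ∣C∣≡1 = inj₁ (∣C∣≡1 , no-edges (edgesWithin H C) (singleton⇒no-edges H ∣C∣≡1) ,
                              ∑ᴸ-block-singleton ∣C∣≡1 f₀)
        where
        no-edges : ∀ es → (∀ {e} → ¬ e ∈ˡ es) → ¬ 1 ℕ.≤ length es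
        no-edges (e ∷ es) none _ = none (here ≡.refl)
      ... | no ∣C∣≢1 with e , e∈ ← component-edge H (∈-components⁻ H C∈) ∣C∣≢1 =
        inj₂ (∣C∣≢1 , ∈-length e∈ , ∑ᴸ-block bip (∈-components⁻ H C∈) e∈ f₀)

-- From the coefficients d_k to a sum over dominating sets

module CountingSums (R : CommutativeRing 0ℓ 0ℓ) (x : CommutativeRing.Carrier R) where
  open CommutativeRing R hiding (zero)
  open RawSemiringDefinitions (Semiring.rawSemiring semiring) using (_^_) renaming (_×_ to _·_)
  open RingSums R
  open import Relation.Binary.Reasoning.Setoid setoid

  ∑-count : ∀ {P : A → Set} (P? : Decidable P) xs →
    length (filter P? xs) · 1# ≈ ∑ xs (λ a → if does (P? a) then 1# else 0#)
  ∑-count P? []       = refl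
  ∑-count P? (a ∷ xs) with does (P? a)
  ... | true  = +-congˡ (∑-count P? xs)
  ... | false = trans (∑-count P? xs) (sym (+-identityˡ _))

  ∑-pick : ∀ (_≟_ : DecidableEquality A) {xs} (f : A → Carrier) → Unique xs → ∀ {a} → a ∈ˡ xs →
    ∑ xs (λ b → if does (a ≟ b) then f b else 0#) ≈ f a
  ∑-pick _≟_ {b ∷ xs} f (b∉xs ∷ uniq) {a} (here ≡.refl) = trans
    (+-cong (reflexive (cong (if_then f a else 0#) (dec-true (a ≟ a) ≡.refl)))
            (∑-zero xs λ {c} c∈ → reflexive (cong (if_then f c else 0#)
              (dec-false (a ≟ c) (All.lookup b∉xs c∈)))))
    (+-identityʳ _)
  ∑-pick _≟_ {b ∷ xs} f (b∉xs ∷ uniq) {a} (there a∈) = trans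
    (+-cong (reflexive (cong (if_then f b else 0#)
              (dec-false (a ≟ b) (All.lookup b∉xs a∈ ∘ ≡.sym))))
            (∑-pick _≟_ f uniq a∈))
    (+-identityˡ _)

  ∑-d : (G : Graph n) → ∑ (upTo (suc n)) (λ k → (d k G · 1#) * x ^ k) ≈
    ∑ (subsets n) (λ W → if does (dominating? G W) then x ^ ∣ W ∣ else 0#)
  ∑-d {n} G = begin
    ∑ (upTo (suc n)) (λ k → (d k G · 1#) * x ^ k)
      ≈⟨ ∑-cong (upTo (suc n)) (λ {k} _ → expand k) ⟩
    ∑ (upTo (suc n)) (λ k → ∑ (subsets n) λ W → term k W)
      ≈⟨ ∑-swap (upTo (suc n)) (subsets n) term ⟩
    ∑ (subsets n) (λ W → ∑ (upTo (suc n)) λ k → term k W)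
      ≈⟨ ∑-cong (subsets n) (λ {W} _ → collapse W) ⟩
    ∑ (subsets n) (λ W → if does (dominating? G W) then x ^ ∣ W ∣ else 0#) ∎
    where
    counted? : ∀ k (W : Subset n) → Dec (Dominating G W × ∣ W ∣ ≡ k)
    counted? k W = dominating? G W ×-dec (∣ W ∣ ℕ.≟ k)

    term : ℕ → Subset n → Carrier
    term k W = if does (counted? k W) then x ^ k else 0#

    indicator : ∀ b c → (if b then 1# else 0#) * c ≈ (if b then c else 0#)
    indicator true  c = *-identityˡ c
    indicator false c = zeroˡ c

    expand : ∀ k → (d k G · 1#) * x ^ k ≈ ∑ (subsets n) (term k)
    expand k = begin
      (d k G · 1#) * x ^ k
        ≈⟨ *-congʳ (∑-count (counted? k) (subsets n)) ⟩
      ∑ (subsets n) (λ W → if does (counted? k W) then 1# else 0#) * x ^ k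
        ≈⟨ ∑-*ʳ (x ^ k) (subsets n) _ ⟩
      ∑ (subsets n) (λ W → (if does (counted? k W) then 1# else 0#) * x ^ k)
        ≈⟨ ∑-cong (subsets n) (λ {W} _ → indicator (does (counted? k W)) (x ^ k)) ⟩
      ∑ (subsets n) (term k) ∎

    collapse : ∀ W → ∑ (upTo (suc n)) (λ k → term k W) ≈
      (if does (dominating? G W) then x ^ ∣ W ∣ else 0#)
    collapse W with does (dominating? G W)
    -- For dominating W the test in `term` reduces to comparing k with `∣ W ∣`, and `∣ W ∣` is at
    -- most n, hence in the range.
    ... | true  = ∑-pick ℕ._≟_ (x ^_) (Unique.upTo⁺ (suc n)) (∈-upTo⁺ (s≤s (∣p∣≤n W)))
    ... | false = ∑-zero (upTo (suc n)) λ _ → refl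

-- The formula over an arbitrary commutative ring

module DominationFormula (R : CommutativeRing 0ℓ 0ℓ) (x : CommutativeRing.Carrier R) where
  open CommutativeRing R hiding (zero)
  open RawSemiringDefinitions (Semiring.rawSemiring semiring) using (_^_) renaming (_×_ to _·_)
  open RingSums R
  open LabellingSums R labels
  open DominationSums R x
  open ComponentSums R x
  open CountingSums R x
  open import Relation.Binary.Reasoning.Setoid setoid

  -- In ℤ[x] the coefficients and signs are constants computed in ℤ, which equal the multiples of
  -- `1#` and the powers of `- 1#` only up to `≈`. With `c` and `sgn` as parameters, the instance is
  -- the theorem by definition.
  domination-formula :
    ∀ (c sgn : ℕ → Carrier) → (∀ m → c m ≈ m · 1#) → (∀ m → sgn m ≈ (- 1#) ^ m) →
    (G : Graph n) (Y Z : EdgeSubset G → Subset n) →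
    (∀ B → Bipartite (spanning G B) → IsBipartition (spanning G B) (Y B) (Z B)) →
    ∑ (upTo (suc n)) (λ k → c (d k G) * x ^ k) ≈
    ∑ (bipartiteSubsets G) (λ B → summand sgn (spanning G B) (Y B) (Z B))
  domination-formula {n} c sgn c≈ sgn≈ G Y Z bip = begin
    ∑ (upTo (suc n)) (λ k → c (d k G) * x ^ k)
      ≈⟨ ∑-cong (upTo (suc n)) (λ {k} _ → *-congʳ (c≈ (d k G))) ⟩
    ∑ (upTo (suc n)) (λ k → (d k G · 1#) * x ^ k)
      ≈⟨ ∑-d G ⟩
    ∑ (subsets n) (λ W → if does (dominating? G W) then x ^ ∣ W ∣ else 0#)
      ≈⟨ dominating-sum G f₀ ⟩
    ∑ Bs (λ B → ∑ᴸ (allFin n) f₀ (weight (spanning G B)))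
      ≈⟨ ∑-cong Bs (λ {B} _ → evaluate B) ⟩
    ∑ Bs (λ B → if does (bipartite? (spanning G B)) then h′ B else 0#)
      ≈⟨ ∑-filter (λ B → bipartite? (spanning G B)) Bs h′ ⟨
    ∑ (bipartiteSubsets G) h′
      ≈⟨ ∑-cong (bipartiteSubsets G) (λ {B} _ → summand-cong sgn≈ (spanning G B) (Y B) (Z B)) ⟨
    ∑ (bipartiteSubsets G) (λ B → summand sgn (spanning G B) (Y B) (Z B)) ∎
    where
    Bs = subsets (length (edges G))
    f₀ = Vec.replicate n (false , false)
    h′ : EdgeSubset G → Carrier
    h′ B = summand ((- 1#) ^_) (spanning G B) (Y B) (Z B)
    evaluate : ∀ B → ∑ᴸ (allFin n) f₀ (weight (spanning G B)) ≈
      (if does (bipartite? (spanning G B)) then h′ B else 0#)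
    evaluate B with bipartite? (spanning G B)
    ... | yes b = ∑ᴸ-weight-bipartite (spanning G B) (bip B b) f₀
    ... | no ¬b = ∑ᴸ-weight-¬bipartite (spanning G B) ¬b f₀

-- The ring ℤ[x]

-- The ring laws of ℤ[x] are pulled back along coeff from the ring of formal power series.
module Series where
  open import Data.Integer using (_+_; _*_; -_)

  Series : Set
  Series = ℕ → ℤ

  infixl 7 _⊛_
  -- Cauchy product, by splitting off the constant term of the left factor: f = f(0) + x f′. The
  -- product of coefficient lists follows the same recursion.
  _⊛_ : Series → Series → Series
  (f ⊛ g) zero    = f 0 * g 0
  (f ⊛ g) (suc k) = f 0 * g (suc k) + ((f ∘ suc) ⊛ g) k

  one : Series
  one zero    = 1ℤ
  one (suc _) = 0ℤ

  ⊛-cong : ∀ {f f′ g g′} → f ≗ f′ → g ≗ g′ → f ⊛ g ≗ f′ ⊛ g′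
  ⊛-cong p q zero    = cong₂ _*_ (p 0) (q 0)
  ⊛-cong p q (suc k) =
    cong₂ _+_ (cong₂ _*_ (p 0) (q (suc k))) (⊛-cong (p ∘ suc) q k)

  -- The mirror recursion, splitting the right factor instead; commutativity follows by comparing
  -- the two.
  ⊛-suc : ∀ f g k → (f ⊛ g) (suc k) ≡ f (suc k) * g 0 + (f ⊛ (g ∘ suc)) k
  ⊛-suc f g zero    = ℤ.+-comm (f 0 * g 1) (f 1 * g 0)
  ⊛-suc f g (suc k) = ≡.trans (cong ((f 0 * g (suc (suc k))) +_) (⊛-suc (f ∘ suc) g k))
    (shuffle (f 0 * g (suc (suc k))) (f (suc (suc k)) * g 0) _)
    where
    shuffle : ∀ a b c → a + (b + c) ≡ b + (a + c)
    shuffle = solve-∀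

  ⊛-comm : ∀ f g → f ⊛ g ≗ g ⊛ f
  ⊛-comm f g zero    = ℤ.*-comm (f 0) (g 0)
  ⊛-comm f g (suc k) = ≡.trans
    (cong₂ _+_ (ℤ.*-comm (f 0) (g (suc k))) (⊛-comm (f ∘ suc) g k))
    (≡.sym (⊛-suc g f k))

  ⊛-distribʳ : ∀ h f g → (λ i → f i + g i) ⊛ h ≗ λ k → (f ⊛ h) k + (g ⊛ h) k
  ⊛-distribʳ h f g zero    = ℤ.*-distribʳ-+ (h 0) (f 0) (g 0)
  ⊛-distribʳ h f g (suc k) = ≡.trans
    (cong (((f 0 + g 0) * h (suc k)) +_) (⊛-distribʳ h (f ∘ suc) (g ∘ suc) k))
    (shuffle (f 0) (g 0) (h (suc k)) _ _)
    where
    shuffle : ∀ a b c d e → (a + b) * c + (d + e) ≡ (a * c + d) + (b * c + e)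
    shuffle = solve-∀

  ⊛-scaleˡ : ∀ a f g → (λ i → a * f i) ⊛ g ≗ λ k → a * (f ⊛ g) k
  ⊛-scaleˡ a f g zero    = ℤ.*-assoc a (f 0) (g 0)
  ⊛-scaleˡ a f g (suc k) = ≡.trans
    (cong ((a * f 0 * g (suc k)) +_) (⊛-scaleˡ a (f ∘ suc) g k))
    (shuffle a (f 0) (g (suc k)) _)
    where
    shuffle : ∀ a b c d → a * b * c + a * d ≡ a * (b * c + d)
    shuffle = solve-∀

  -- The tail of f ⊛ g is f(0) times the tail of g plus (tail of f) ⊛ g, so the induction needs
  -- distributivity and scaling first.
  ⊛-assoc : ∀ f g h → (f ⊛ g) ⊛ h ≗ f ⊛ (g ⊛ h)
  ⊛-assoc f g h zero    = ℤ.*-assoc (f 0) (g 0) (h 0)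
  ⊛-assoc f g h (suc k) = begin
    f 0 * g 0 * h (suc k) + ((λ i → f 0 * g (suc i) + ((f ∘ suc) ⊛ g) i) ⊛ h) k
      ≡⟨ cong ((f 0 * g 0 * h (suc k)) +_) (⊛-distribʳ h (λ i → f 0 * g (suc i)) ((f ∘ suc) ⊛ g) k) ⟩
    f 0 * g 0 * h (suc k) +
      (((λ i → f 0 * g (suc i)) ⊛ h) k + (((f ∘ suc) ⊛ g) ⊛ h) k)
      ≡⟨ cong ((f 0 * g 0 * h (suc k)) +_)
           (cong₂ _+_ (⊛-scaleˡ (f 0) (g ∘ suc) h k) (⊛-assoc (f ∘ suc) g h k)) ⟩
    f 0 * g 0 * h (suc k) +
      (f 0 * ((g ∘ suc) ⊛ h) k + ((f ∘ suc) ⊛ (g ⊛ h)) k)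
      ≡⟨ shuffle (f 0) (g 0) (h (suc k)) _ _ ⟩
    f 0 * (g ⊛ h) (suc k) + ((f ∘ suc) ⊛ (g ⊛ h)) k ∎
    where
    open ≡.≡-Reasoning
    shuffle : ∀ a b c d e → a * b * c + (a * d + e) ≡ a * (b * c + d) + e
    shuffle = solve-∀

  ⊛-zeroˡ : ∀ g → (λ _ → 0ℤ) ⊛ g ≗ λ _ → 0ℤ
  ⊛-zeroˡ g zero    = ≡.refl
  ⊛-zeroˡ g (suc k) = ≡.trans (ℤ.+-identityˡ _) (⊛-zeroˡ g k)

  ⊛-identityˡ : ∀ g → one ⊛ g ≗ g
  ⊛-identityˡ g zero    = ℤ.*-identityˡ (g 0)
  ⊛-identityˡ g (suc k) = ≡.trans
    (cong₂ _+_ (ℤ.*-identityˡ (g (suc k))) (⊛-zeroˡ g k)) (ℤ.+-identityʳ _)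

  rawRing : RawRing 0ℓ 0ℓ
  rawRing = record
    { Carrier = Series
    ; _≈_     = _≗_
    ; _+_     = λ f g k → f k + g k
    ; _*_     = _⊛_
    ; -_      = λ f k → - f k
    ; 0#      = λ _ → 0ℤ
    ; 1#      = one
    }

  isCommutativeRing :
    IsCommutativeRing _≗_ (λ f g k → f k + g k) _⊛_ (λ f k → - f k) (λ _ → 0ℤ) one
  isCommutativeRing = record
    { isRing = record
      { +-isAbelianGroup = Pointwise.isAbelianGroup ℕ ℤ.+-0-isAbelianGroup
      ; *-cong           = ⊛-cong
      ; *-assoc          = ⊛-assoc
      ; *-identity       = ⊛-identityˡ ,
                           λ g k → ≡.trans (⊛-comm g one k) (⊛-identityˡ g k)
      ; distrib          = (λ h f g k → ≡.trans (⊛-comm h _ k)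
                             (≡.trans (⊛-distribʳ h f g k)
                               (cong₂ _+_ (⊛-comm f h k) (⊛-comm g h k)))) ,
                           ⊛-distribʳ
      }
    ; *-comm = ⊛-comm
    }

open import Defs using (_≈_; _+_; _*_; _^_; ∑)

coeff-+ : ∀ p q k → coeff (p + q) k ≡ coeff p k ℤ.+ coeff q k
coeff-+ []      q       k       = ≡.sym (ℤ.+-identityˡ _)
coeff-+ (a ∷ p) []      k       = ≡.sym (ℤ.+-identityʳ _)
coeff-+ (a ∷ p) (b ∷ q) zero    = ≡.refl
coeff-+ (a ∷ p) (b ∷ q) (suc k) = coeff-+ p q k

coeff-map : ∀ (f : ℤ → ℤ) → f 0ℤ ≡ 0ℤ → ∀ p k → coeff (map f p) k ≡ f (coeff p k)
coeff-map f f0 []      k       = ≡.sym f0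
coeff-map f f0 (a ∷ p) zero    = ≡.refl
coeff-map f f0 (a ∷ p) (suc k) = coeff-map f f0 p k

coeff-* : ∀ p q k → coeff (p * q) k ≡ (coeff p Series.⊛ coeff q) k
coeff-* []      q k = ≡.sym (Series.⊛-zeroˡ (coeff q) k)
coeff-* (a ∷ p) q k = ≡.trans (coeff-+ (map (a ℤ.*_) q) (0ℤ ∷ p * q) k) (lemma k)
  where
  scaled = coeff-map (a ℤ.*_) (ℤ.*-zeroʳ a) q
  lemma : ∀ k → coeff (map (a ℤ.*_) q) k ℤ.+ coeff (0ℤ ∷ p * q) k ≡
                (coeff (a ∷ p) Series.⊛ coeff q) k
  lemma zero    = ≡.trans (ℤ.+-identityʳ _) (scaled 0)
  lemma (suc k) = cong₂ ℤ._+_ (scaled (suc k)) (coeff-* p q k)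

polyRawRing : RawRing 0ℓ 0ℓ
polyRawRing = record
  { Carrier = Poly
  ; _≈_     = _≈_
  ; _+_     = _+_
  ; _*_     = _*_
  ; -_      = map (ℤ.-_)
  ; 0#      = []
  ; 1#      = const 1ℤ
  }

coeff-isRingMonomorphism : IsRingMonomorphism polyRawRing Series.rawRing coeff
coeff-isRingMonomorphism = record
  { isRingHomomorphism = record
    { isSemiringHomomorphism = record
      { isNearSemiringHomomorphism = record
        { +-isMonoidHomomorphism = record
          { isMagmaHomomorphism = record
            { isRelHomomorphism = record { cong = λ p → p }
            ; homo = coeff-+
            }
          ; ε-homo = λ _ → ≡.refl
          }
        ; *-homo = coeff-*
        }
      ; 1#-homo = λ { zero → ≡.refl ; (suc _) → ≡.refl }
      }
    ; -‿homo = coeff-map ℤ.-_ ≡.refl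
    }
  -- `p ≈ q` is by definition equality of all coefficients.
  ; injective = λ p → p
  }

polyCommutativeRing : CommutativeRing 0ℓ 0ℓ
polyCommutativeRing = record
  { isCommutativeRing =
      RingMonomorphism.isCommutativeRing coeff-isRingMonomorphism Series.isCommutativeRing
  }

module ℤ[X] = CommutativeRing polyCommutativeRing
open RawSemiringDefinitions polyRawSemiring using () renaming (_×_ to _·_)

-- The zero polynomial appears as `0ℤ ∷ []` on the left and as `[]` on the right, hence the
-- comparison by coefficients.
const-· : ∀ m → const (ℤ.+ m) ≈ m · const 1ℤ
const-· zero    zero    = ≡.refl
const-· zero    (suc _) = ≡.refl
const-· (suc m) = ℤ[X].+-congˡ {const 1ℤ} {const (ℤ.+ m)} {m · const 1ℤ} (const-· m)

const-* : ∀ a b → const (a ℤ.* b) ≈ const a * const b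
const-* a b zero    = ≡.sym (ℤ.+-identityʳ _)
const-* a b (suc _) = ≡.refl

sign-^ : ∀ m → sign m ≈ const -1ℤ ^ m
sign-^ zero    = ℤ[X].refl {const 1ℤ}
sign-^ (suc m) = ℤ[X].trans {sign (suc m)} {const -1ℤ * sign m} {const -1ℤ ^ suc m}
  (const-* -1ℤ (-1ℤ ℤ.^ m))
  (ℤ[X].*-congˡ {const -1ℤ} {sign m} {const -1ℤ ^ m} (sign-^ m))

mainTheorem1 : (n : ℕ) (G : Graph n) (Y Z : EdgeSubset G → Subset n) →
    (∀ B → Bipartite (spanning G B) → IsBipartition (spanning G B) (Y B) (Z B)) →
    D G ≈ ∑ (bipartiteSubsets G) (λ B → h (spanning G B) (Y B) (Z B))
mainTheorem1 n G = DominationFormula.domination-formula polyCommutativeRing X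
  (const ∘ ℤ.+_) sign const-· sign-^ G
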